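{- Let $n\ge1$ and $r\ge2$ be integers, let $S=(s_1,\dots,s_n)$ be an integer vector with $0\le s_i\le r$, let $\mathcal{F}$ be a family of non-empty subsets of $[n]$, and let $\mathcal{P}=\{P_1,\dots,P_l\}$ be a partition of $[n]$ such that $w_S(P_j)\le r$ for every $j$. Then $$\chi(\mathrm{KG}_S^r(\mathcal{F},\mathcal{P}))\ge\left\lceil\frac{\mathrm{ecd}_S^r(\mathcal{F})}{r-1}\right\rceil.$$
   Context: For $P\subseteq[n]$, its $S$-weight is $w_S(P)=\sum_{i\in P}s_i$. A multiset $\{A_1,\dots,A_r\}$ of subsets of $[n]$ is $S$-disjoint if for every $i\in[n]$ the number of $j\in\{1,\dots,r\}$ with $i\in A_j$ is at most $s_i$. It is equitable if $||A_i|-|A_j||\le1$ for all $i,j$. Let $\bar n=\sum_{i=1}^ns_i$. The equitable $S$-disjoint $r$-colorability defect is $$\mathrm{ecd}_S^r(\mathcal{F})=\bar n-\max\Big\{\sum_{i=1}^r|A_i| : \{A_1,\dots,A_r\}\text{ equitable and }S\text{ -disjoint, and }F\not\subseteq A_i\ \forall F\in\mathcal{F},\ 1\le i\le r\Big\}.$$ $\mathrm{KG}_S^r(\mathcal{F},\mathcal{P})$ is the $r$-uniform hypergraph whose vertices are those $A\in\mathcal{F}$ with $|A\cap P_j|\le1$ for all $j$, and whose edges are all multisets $\{A_1,\dots,A_r\}$ of vertices that are $S$-disjoint. $\chi$ is the chromatic number (minimum number of colors in a vertex coloring with no monochromatic edge). -}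

module Defs where

open import Data.Nat using (ℕ; zero; suc; _+_; _∸_; _≤_)
open import Data.Nat.DivMod using (_/_)
open import Data.Fin using (Fin)
open import Data.Fin.Subset using (Subset; _∈_; _⊆_; _∩_; ∣_∣; Nonempty; inside; outside)
open import Data.Vec using (lookup; tabulate; sum)
open import Data.Bool using (Bool; T)
open import Data.Product using (Σ; ∃; ∃-syntax; _×_)
open import Relation.Nullary using (¬_)
open import Relation.Binary.PropositionalEquality using (_≡_)

-- Ground set [n] is Fin n; subsets of [n] are Data.Fin.Subset.Subset n.
-- S = (s_1,…,s_n) is a function s : Fin n → ℕ.
-- A family 𝓕 of subsets of [n] is a Boolean indicator F : Subset n → Bool.
-- A multiset {A_1,…,A_r} is represented by an indexed tuple A : Fin r → Subset n.

-- ceiling division ⌈ m / d ⌉ (only used with d ≥ 1; value at d = 0 irrelevant)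
ceilDiv : ℕ → ℕ → ℕ
ceilDiv m zero    = 0
ceilDiv m (suc d) = (m + d) / suc d

wt : ∀ {n} → (Fin n → ℕ) → Subset n → ℕ
wt s P = sum (tabulate λ i → sel (lookup P i) (s i))
  where
  sel : _ → ℕ → ℕ
  sel inside  x = x
  sel outside _ = 0

nbar : ∀ {n} → (Fin n → ℕ) → ℕ
nbar s = sum (tabulate s)

mult : ∀ {n r} → (Fin r → Subset n) → Fin n → ℕ
mult A i = ∣ tabulate (λ j → lookup (A j) i) ∣

SDisjoint : ∀ {n r} → (Fin n → ℕ) → (Fin r → Subset n) → Set
SDisjoint s A = ∀ i → mult A i ≤ s i

Equitable : ∀ {n r} → (Fin r → Subset n) → Set
Equitable A = ∀ i j → ∣ A i ∣ ≤ suc ∣ A j ∣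

FFree : ∀ {n r} → (Subset n → Bool) → (Fin r → Subset n) → Set
FFree F A = ∀ B → T (F B) → ∀ i → ¬ (B ⊆ A i)

Admissible : ∀ {n r} → (Fin n → ℕ) → (Subset n → Bool) → (Fin r → Subset n) → Set
Admissible s F A = Equitable A × SDisjoint s A × FFree F A

total : ∀ {n r} → (Fin r → Subset n) → ℕ
total A = sum (tabulate λ j → ∣ A j ∣)

IsMaxTotal : ∀ {n} (r : ℕ) → (Fin n → ℕ) → (Subset n → Bool) → ℕ → Set
IsMaxTotal {n} r s F M =
  (∃[ A ] (Admissible {n} {r} s F A × total A ≡ M)) ×
  (∀ (A : Fin r → Subset n) → Admissible s F A → total A ≤ M)

IsECD : ∀ {n} (r : ℕ) → (Fin n → ℕ) → (Subset n → Bool) → ℕ → Set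
IsECD r s F e = ∃[ M ] (IsMaxTotal r s F M × e ≡ nbar s ∸ M)

IsPartition : ∀ {n l} → (Fin l → Subset n) → Set
IsPartition {n} {l} P =
  (∀ j → Nonempty (P j)) ×
  (∀ (i : Fin n) → ∃[ j ] (i ∈ P j × ∀ j' → i ∈ P j' → j' ≡ j))

KGVertex : ∀ {n l} → (Subset n → Bool) → (Fin l → Subset n) → Set
KGVertex {n} F P = Σ (Subset n) λ A → T (F A) × (∀ j → ∣ A ∩ P j ∣ ≤ 1)

KGEdge : ∀ {n l} (r : ℕ) → (Fin n → ℕ) → (F : Subset n → Bool) → (P : Fin l → Subset n)
       → (Fin r → KGVertex F P) → Set
KGEdge r s F P e = SDisjoint s (λ j → Σ.proj₁ (e j))
  where open Data.Product

ProperKG : ∀ {n l} (r : ℕ) → (Fin n → ℕ) → (F : Subset n → Bool) → (P : Fin l → Subset n)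
         → (k : ℕ) → (KGVertex F P → Fin k) → Set
ProperKG r s F P k c =
  ∀ (e : Fin r → KGVertex F P) → KGEdge r s F P e → ¬ (∃[ col ] ∀ j → c (e j) ≡ col)

-- χ(KG_S^r(𝓕,𝓟)) ≥ m : every proper coloring uses at least m colors
-- (if no proper coloring exists, χ = ∞ and this holds vacuously)
χKG≥ : ∀ {n l} (r : ℕ) → (Fin n → ℕ) → (F : Subset n → Bool) → (P : Fin l → Subset n) → ℕ → Set
χKG≥ r s F P m = ∀ (k : ℕ) (c : KGVertex F P → Fin k) → ProperKG r s F P k c → m ≤ k

{-# OPTIONS --safe #-}

-- Replace every i by s i copies.  A colouring of the hypergraph then gives, for each colour a, a family
-- G a of sets, no r disjoint transversals of which all belong to G a, and the theorem asks for r
-- disjoint transversals outside all G a whose sizes, cut down to one more than the least of them, sum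
-- up to at least n̄ − (r − 1) k.
--
-- For r = p prime, let X run over the partial p-colourings of the ground set, that is the simplices of
-- (ℤ_p)^{*n̄}.  If some class of X contains a transversal in some G a, label X with the first such a and
-- the number of these classes, which is less than p.  Otherwise label X with the sum of the numbers of
-- parts met by its classes, cut down as above.  If X ⊆ Y have the same label, they determine the same
-- proper nonempty subset of ℤ_p (the classes in question; or those which meet more parts than the
-- least; or those which meet a given part, if these are neither all nor none; and else X = Y, since a
-- part which meets all p classes has no further elements).  Averaging this subset modulo p gives an equivariant sign, so
-- if the claim failed, (ℤ_p)^{*n̄} would map equivariantly to (ℤ_p)^{*(n̄−1)}.  Composing a chain h of
-- (ℤ_p)^{*n̄} with boundary relations ∂h_{n+1} = ν h_n or τ h_n with cochains U of the target that satisfy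
-- the dual relations, which exist because the target is free and vanish above its dimension, yields
-- 1 ≡ 0 modulo p.
--
-- For r = r₂ r₁, cut every part into r₁ parts of at most r₂ elements and apply the case r₂ to the sets
-- that contain r₁ disjoint transversals from one G a; inside the resulting sets apply the case r₁.

module Submission where

open import Defs

-- Simplicial cochains, cones, and the operators of a cyclic group

module Cochains where

  open import Data.Nat using (ℕ; zero; suc)
  open import Data.Integer using (ℤ; +_; -[1+_]; 0ℤ; _+_; _*_; _-_; -_)
  import Data.Integer.Properties as ℤ
  open import Data.Integer.Tactic.RingSolver using (solve-∀)
  open import Data.Integer.Divisibility.Signed using () renaming (_∣_ to _∣ℤ_)
  open import Data.List using (List; []; _∷_; map; _++_)
  open import Data.List.Membership.Propositional using (_∈_)
  open import Data.List.Relation.Binary.Subset.Propositional using (_⊆_)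
  open import Data.List.Relation.Unary.Any using (here; there)
  open import Function using (_∘_)
  open import Relation.Binary.PropositionalEquality

  -- Ordered cochains in all degrees at once, on arbitrary vertex lists. Which lists are simplices
  -- is stated separately, by predicates such as `Chain` and `Consistent`.
  Cochain : Set → Set
  Cochain V = List V → ℤ

  cofactor : ∀ {V} → V → Cochain V → Cochain V
  cofactor x w xs = w (x ∷ xs)

  -- Unfolds to the alternating sum of `w` over the lists with one entry deleted. The empty list
  -- counts as a face of every vertex, so the augmentation is included.
  δ : ∀ {V} → Cochain V → Cochain V
  δ w []       = 0ℤ
  δ w (x ∷ xs) = w xs - δ (cofactor x w) xs

  module _ {V : Set} where

    -- Only faces of `xs` are evaluated. The restriction to `ys ⊆ xs` matters in `κ-U`, where the
    -- equation holds on consistent lists only.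
    δ-cong : {w w′ : Cochain V} → ∀ xs → (∀ {ys} → ys ⊆ xs → w ys ≡ w′ ys) → δ w xs ≡ δ w′ xs
    δ-cong []       eq = refl
    δ-cong {w} {w′} (x ∷ xs) eq = cong₂ _-_ (eq there)
      (δ-cong xs λ ys⊆xs → eq λ { (here p) → here p ; (there p) → there (ys⊆xs p) })

    δ-cong-≗ : {w w′ : Cochain V} → w ≗ w′ → δ w ≗ δ w′
    δ-cong-≗ eq xs = δ-cong xs λ {ys} _ → eq ys

    δ-+ : (w w′ : Cochain V) → ∀ xs → δ (λ ys → w ys + w′ ys) xs ≡ δ w xs + δ w′ xs
    δ-+ w w′ []       = refl
    δ-+ w w′ (x ∷ xs) = trans (cong (λ z → w xs + w′ xs - z) (δ-+ (cofactor x w) (cofactor x w′) xs))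
      (lem (w xs) (w′ xs) _ _)
      where
      lem : ∀ a b c d → a + b - (c + d) ≡ (a - c) + (b - d)
      lem = solve-∀

    δ-neg : (w : Cochain V) → ∀ xs → δ (λ ys → - w ys) xs ≡ - δ w xs
    δ-neg w []       = refl
    δ-neg w (x ∷ xs) = trans (cong (λ z → - w xs - z) (δ-neg (cofactor x w) xs)) (lem (w xs) _)
      where
      lem : ∀ a c → - a - (- c) ≡ - (a - c)
      lem = solve-∀

    δ-minus : (w w′ : Cochain V) → ∀ xs → δ (λ ys → w ys - w′ ys) xs ≡ δ w xs - δ w′ xs
    δ-minus w w′ xs = trans (δ-+ w (λ ys → - w′ ys) xs) (cong (λ z → δ w xs + z) (δ-neg w′ xs))

    δ-0 : ∀ xs → δ {V} (λ _ → 0ℤ) xs ≡ 0ℤ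
    δ-0 []       = refl
    δ-0 (x ∷ xs) = cong (λ z → 0ℤ - z) (δ-0 xs)

    δδ : (w : Cochain V) → ∀ xs → δ (δ w) xs ≡ 0ℤ
    δδ w []       = refl
    δδ w (x ∷ xs) = begin
      δ w xs - δ (λ ys → w ys - δ (cofactor x w) ys) xs
        ≡⟨ cong (λ z → δ w xs - z) (δ-minus w (δ (cofactor x w)) xs) ⟩
      δ w xs - (δ w xs - δ (δ (cofactor x w)) xs)
        ≡⟨ cong (λ z → δ w xs - (δ w xs - z)) (δδ (cofactor x w) xs) ⟩
      δ w xs - (δ w xs - 0ℤ)
        ≡⟨ lem (δ w xs) ⟩
      0ℤ ∎
      where
      open ≡-Reasoning
      lem : ∀ a → a - (a - 0ℤ) ≡ 0ℤ
      lem = solve-∀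

  δ-map : ∀ {V V′ : Set} (f : V → V′) (w : Cochain V′) → ∀ xs → δ w (map f xs) ≡ δ (w ∘ map f) xs
  δ-map f w []       = refl
  δ-map f w (x ∷ xs) = cong (λ z → w (map f xs) - z) (δ-map f (cofactor (f x) w) xs)

  module Cone {V V′ : Set} (e plus : V → V′) (v : V′) where

    -- Dual to the triangulated prism between two copies of a simplex: the alternating sum over i of
    -- `w` at e x₀ ... e xᵢ, plus xᵢ ... plus xₙ.
    prism : Cochain V′ → Cochain V
    prism w []       = 0ℤ
    prism w (x ∷ xs) = w (e x ∷ map plus (x ∷ xs)) - prism (cofactor (e x) w) xs

    -- Dual to a cone over the image under `e`. In the application the apex `v` is comparable with
    -- `plus x` but not with `e x`, so the cone is taken over `plus` and a prism leads from there to
    -- `e`.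
    cone : Cochain V′ → Cochain V
    cone w xs = w (v ∷ map plus xs) - prism w xs

    prism-minus : (w w′ : Cochain V′) → ∀ xs → prism (λ ys → w ys - w′ ys) xs ≡ prism w xs - prism w′ xs
    prism-minus w w′ []       = refl
    prism-minus w w′ (x ∷ xs) = trans
      (cong (λ z → w (e x ∷ map plus (x ∷ xs)) - w′ (e x ∷ map plus (x ∷ xs)) - z)
            (prism-minus (cofactor (e x) w) (cofactor (e x) w′) xs))
      (lem (w _) (w′ _) (prism (cofactor (e x) w) xs) (prism (cofactor (e x) w′) xs))
      where
      lem : ∀ a b c d → a - b - (c - d) ≡ (a - c) - (b - d)
      lem = solve-∀

    -- The dual of ∂P + P∂ = plus - e. In the induction on the list, the terms `D` come from walls
    -- inside the prism and cancel.
    prism-homotopy : (w : Cochain V′) → ∀ xs →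
      prism (δ w) xs + δ (prism w) xs ≡ w (map plus xs) - w (map e xs)
    prism-homotopy w []       = lem (w [])
      where
      lem : ∀ a → 0ℤ ≡ a - a
      lem = solve-∀
    prism-homotopy w (x ∷ xs) = begin
      (w (plus x ∷ P) - (wₓ P - δ (cofactor (plus x) wₓ) P) - prism (λ ys → w ys - δ wₓ ys) xs)
        + (prism w xs - δ (λ ys → wₓ (plus x ∷ map plus ys) - prism wₓ ys) xs)
        ≡⟨ cong₂ (λ a b → (w (plus x ∷ P) - (wₓ P - δ (cofactor (plus x) wₓ) P) - a)
                           + (prism w xs - b))
             (prism-minus w (δ wₓ) xs)
             (trans (δ-minus (λ ys → wₓ (plus x ∷ map plus ys)) (prism wₓ) xs)
                    (cong (_- δ (prism wₓ) xs) (sym (δ-map plus (cofactor (plus x) wₓ) xs)))) ⟩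
      (w (plus x ∷ P) - (wₓ P - D) - (prism w xs - prism (δ wₓ) xs))
        + (prism w xs - (D - δ (prism wₓ) xs))
        ≡⟨ lem₁ (w (plus x ∷ P)) (wₓ P) D (prism w xs) (prism (δ wₓ) xs) (δ (prism wₓ) xs) ⟩
      w (plus x ∷ P) - wₓ P + (prism (δ wₓ) xs + δ (prism wₓ) xs)
        ≡⟨ cong (λ z → w (plus x ∷ P) - wₓ P + z) (prism-homotopy wₓ xs) ⟩
      w (plus x ∷ P) - wₓ P + (wₓ P - wₓ (map e xs))
        ≡⟨ lem₂ (w (plus x ∷ P)) (wₓ P) (wₓ (map e xs)) ⟩
      w (plus x ∷ P) - w (e x ∷ map e xs) ∎
      where
      open ≡-Reasoning
      wₓ = cofactor (e x) w
      P  = map plus xs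
      D  = δ (cofactor (plus x) wₓ) P
      lem₁ : ∀ a b d c f g → (a - (b - d) - (c - f)) + (c - (d - g)) ≡ a - b + (f + g)
      lem₁ = solve-∀
      lem₂ : ∀ a b c → a - b + (b - c) ≡ a - c
      lem₂ = solve-∀

    cone-homotopy : (w : Cochain V′) → ∀ xs → cone (δ w) xs ≡ w (map e xs) - δ (cone w) xs
    cone-homotopy w xs = begin
      w P - δ wᵥ P - prism (δ w) xs
        ≡⟨ lem (w P) (δ wᵥ P) (prism (δ w) xs) (δ (prism w) xs) ⟩
      w P - (prism (δ w) xs + δ (prism w) xs) - (δ wᵥ P - δ (prism w) xs)
        ≡⟨ cong₂ (λ a b → w P - a - b) (prism-homotopy w xs)
             (trans (cong (_- δ (prism w) xs) (δ-map plus wᵥ xs))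
                    (sym (δ-minus (wᵥ ∘ map plus) (prism w) xs))) ⟩
      w P - (w P - w (map e xs)) - δ (cone w) xs
        ≡⟨ cong (_- δ (cone w) xs) (lem₂ (w P) (w (map e xs))) ⟩
      w (map e xs) - δ (cone w) xs ∎
      where
      open ≡-Reasoning
      wᵥ = cofactor v w
      P  = map plus xs
      lem : ∀ a b c d → a - b - c ≡ a - (c + d) - (b - d)
      lem = solve-∀
      lem₂ : ∀ a b → a - (a - b) ≡ b
      lem₂ = solve-∀

  -- The group ring operators τ = t − 1 and ν = 1 + t + ⋯ + t^(p−1).
  module Rotation {V : Set} (t : V → V) where

    act : ℕ → List V → List V
    act zero    xs = xs
    act (suc n) xs = act n (map t xs)

    τ : Cochain V → Cochain V
    τ w xs = w (map t xs) - w xs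

    ν : ℕ → Cochain V → Cochain V
    ν zero    w xs = 0ℤ
    ν (suc n) w xs = w xs + ν n w (map t xs)

    ν-τ : ∀ n w xs → ν n (τ w) xs ≡ w (act n xs) - w xs
    ν-τ zero    w xs = sym (ℤ.+-inverseʳ (w xs))
    ν-τ (suc n) w xs = trans (cong (λ z → w (map t xs) - w xs + z) (ν-τ n w (map t xs)))
      (lem (w (map t xs)) (w xs) (w (act n (map t xs))))
      where
      lem : ∀ a b c → a - b + (c - a) ≡ c - b
      lem = solve-∀

    ν-+ : ∀ n w w′ xs → ν n (λ ys → w ys + w′ ys) xs ≡ ν n w xs + ν n w′ xs
    ν-+ zero    w w′ xs = refl
    ν-+ (suc n) w w′ xs = trans (cong (λ z → w xs + w′ xs + z) (ν-+ n w w′ (map t xs)))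
      (lem (w xs) (w′ xs) (ν n w (map t xs)) (ν n w′ (map t xs)))
      where
      lem : ∀ a b c d → a + b + (c + d) ≡ (a + c) + (b + d)
      lem = solve-∀

    ν-neg : ∀ n w xs → ν n (λ ys → - w ys) xs ≡ - ν n w xs
    ν-neg zero    w xs = refl
    ν-neg (suc n) w xs = trans (cong (λ z → - w xs + z) (ν-neg n w (map t xs)))
      (sym (ℤ.neg-distrib-+ (w xs) (ν n w (map t xs))))

    τ-ν : ∀ n w xs → τ (ν n w) xs ≡ w (act n xs) - w xs
    τ-ν zero    w xs = sym (ℤ.+-inverseʳ (w xs))
    τ-ν (suc n) w xs = trans (lem (w (map t xs)) (w xs) (ν n w (map t (map t xs))) (ν n w (map t xs)))
      (trans (cong (λ z → w (map t xs) - w xs + z) (τ-ν n w (map t xs)))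
             (lem₂ (w (map t xs)) (w xs) (w (act n (map t xs)))))
      where
      lem : ∀ a b c d → (a + c) - (b + d) ≡ a - b + (c - d)
      lem = solve-∀
      lem₂ : ∀ a b c → a - b + (c - a) ≡ c - b
      lem₂ = solve-∀

    δ-τ : ∀ w xs → δ (τ w) xs ≡ τ (δ w) xs
    δ-τ w xs = trans (δ-minus (w ∘ map t) w xs) (cong (_- δ w xs) (sym (δ-map t w xs)))

    δ-ν : ∀ n w xs → δ (ν n w) xs ≡ ν n (δ w) xs
    δ-ν zero    w xs = δ-0 xs
    δ-ν (suc n) w xs = trans (δ-+ w (ν n w ∘ map t) xs)
      (cong (λ z → δ w xs + z) (trans (sym (δ-map t (ν n w) xs)) (δ-ν n w (map t xs))))

    -- The group fixes the empty list, so the norm becomes multiplication by its length there. This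
    -- is how the modulus p enters, see `H-κκ`.
    ν-[] : ∀ n w → ν n w [] ≡ + n * w []
    ν-[] zero    w = refl
    ν-[] (suc n) w = trans (cong (λ z → w [] + z) (ν-[] n w)) (sym (ℤ.suc-* (+ n) (w [])))

    module _ {P : List V → Set} (P-map : ∀ {xs} → P xs → P (map t xs)) {w w′ : Cochain V}
             (eq : ∀ {xs} → P xs → w xs ≡ w′ xs) where

      τ-cong : ∀ {xs} → P xs → τ w xs ≡ τ w′ xs
      τ-cong px = cong₂ _-_ (eq (P-map px)) (eq px)

      ν-cong : ∀ n {xs} → P xs → ν n w xs ≡ ν n w′ xs
      ν-cong zero    px = refl
      ν-cong (suc n) px = cong₂ _+_ (eq px) (ν-cong n (P-map px))

  -- Makes cochains vanish on lists with repeated entries, which is how the dimension of the target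
  -- complex is felt in `long⇒0`.
  Alternating : ∀ {V} → Cochain V → Set
  Alternating {V} w = ∀ (xs : List V) a b ys →
    w (xs ++ a ∷ b ∷ ys) ≡ - w (xs ++ b ∷ a ∷ ys)

  module _ {V : Set} where
    cofactor-alternating : (x : V) {w : Cochain V} → Alternating w → Alternating (cofactor x w)
    cofactor-alternating x alt xs = alt (x ∷ xs)

    δ-alternating : {w : Cochain V} → Alternating w → Alternating (δ w)
    δ-alternating {w} alt []       a b ys = begin
      w (b ∷ ys) - (w (a ∷ ys) - δ (cofactor b (cofactor a w)) ys)
        ≡⟨ cong (λ z → w (b ∷ ys) - (w (a ∷ ys) - z))
             (trans (δ-cong-≗ (alt [] a b) ys) (δ-neg (cofactor a (cofactor b w)) ys)) ⟩
      w (b ∷ ys) - (w (a ∷ ys) - - D)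
        ≡⟨ lem (w (b ∷ ys)) (w (a ∷ ys)) D ⟩
      - (w (a ∷ ys) - (w (b ∷ ys) - D)) ∎
      where
      open ≡-Reasoning
      D = δ (cofactor a (cofactor b w)) ys
      lem : ∀ a b c → a - (b - - c) ≡ - (b - (a - c))
      lem = solve-∀
    δ-alternating {w} alt (x ∷ xs) a b ys =
      trans (cong₂ _-_ (alt xs a b ys) (δ-alternating (cofactor-alternating x {w} alt) xs a b ys))
            (lem (w (xs ++ b ∷ a ∷ ys)) (δ (cofactor x w) (xs ++ b ∷ a ∷ ys)))
      where
      lem : ∀ a b → - a - - b ≡ - (a - b)
      lem = solve-∀

    private
      -- Here the coefficients have to be integers: modulo 2 every element equals its negative.
      -- Reduction modulo p is therefore postponed to the evaluation by `H`.
      self-neg : ∀ i → i ≡ - i → i ≡ 0ℤ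
      self-neg (+ zero) eq = refl
      self-neg (+ suc n) ()
      self-neg -[1+ n ] ()

    alternating-repeat : {w : Cochain V} → Alternating w → ∀ {a ys} → a ∈ ys → w (a ∷ ys) ≡ 0ℤ
    alternating-repeat {w} alt {a} {.a ∷ ys} (here refl) = self-neg _ (alt [] a a ys)
    alternating-repeat {w} alt {a} {b ∷ ys} (there a∈ys) =
      trans (alt [] a b ys) (cong -_ (alternating-repeat {cofactor b w} (cofactor-alternating b {w} alt) a∈ys))

-- The join of copies of the cyclic group and its chains

module JoinChains where

  open Cochains
  open import Data.Nat as ℕ using (ℕ; zero; suc)
  import Data.Nat.Properties as ℕ
  open import Data.Nat.DivMod using (_%_; _mod_; m%n<n; m<n⇒m%n≡m; [m+n]%n≡m%n; %-distribˡ-+; m%n%n≡m%n)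
  open import Data.Integer using (ℤ; +_; 0ℤ; _+_; _*_; _-_; -_)
  import Data.Integer.Properties as ℤ
  open import Data.Integer.Tactic.RingSolver using (solve-∀)
  open import Data.Integer.Divisibility.Signed as ℤ∣ using (divides) renaming (_∣_ to _∣ℤ_)
  open import Data.Fin as Fin using (Fin; toℕ)
  import Data.Fin.Properties as Fin
  open import Data.List as List using (List; []; _∷_; map; length)
  import Data.List.Properties as List
  open import Data.List.Relation.Unary.All as All using (All; []; _∷_)
  open import Data.List.Relation.Unary.AllPairs as AllPairs using (AllPairs; []; _∷_)
  import Data.List.Relation.Unary.All.Properties as All
  import Data.List.Relation.Unary.AllPairs.Properties as AllPairs
  open import Data.Maybe as Maybe using (Maybe; just; nothing)
  open import Data.Vec as Vec using (Vec; lookup; []; _∷_)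
  import Data.Vec.Properties as Vec
  open import Data.Product using (∃₂; _×_; _,_; proj₁; proj₂)
  open import Data.Unit using (⊤; tt)
  open import Function using (_∘_)
  open import Relation.Binary.PropositionalEquality

  power : {A : Set} → (A → A) → ℕ → A → A
  power t zero    x = x
  power t (suc n) x = power t n (t x)

  act-power : {V : Set} (t : V → V) → ∀ n xs → Rotation.act t n xs ≡ map (power t n) xs
  act-power t zero    xs = sym (List.map-id xs)
  act-power t (suc n) xs = trans (act-power t n (map t xs)) (sym (List.map-∘ xs))

  act-id : {V : Set} (t : V → V) → ∀ n → (∀ x → power t n x ≡ x) → ∀ xs → Rotation.act t n xs ≡ xs
  act-id t n eq xs = trans (act-power t n xs) (trans (List.map-cong eq xs) (List.map-id xs))

  module Sign (q : ℕ) where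

    p : ℕ
    p = suc q

    rot : Fin p → Fin p
    rot i = suc (toℕ i) mod p

    toℕ-mod : ∀ m → toℕ (m mod p) ≡ m % p
    toℕ-mod m = Fin.toℕ-fromℕ< (m%n<n m p)

    toℕ-rot : ∀ i → toℕ (rot i) ≡ suc (toℕ i) % p
    toℕ-rot i = toℕ-mod (suc (toℕ i))

    %-congʳ-+ : ∀ m n → (m ℕ.+ n % p) % p ≡ (m ℕ.+ n) % p
    %-congʳ-+ m n = begin
      (m ℕ.+ n % p) % p             ≡⟨ %-distribˡ-+ m (n % p) p ⟩
      (m % p ℕ.+ n % p % p) % p     ≡⟨ cong (λ z → (m % p ℕ.+ z) % p) (m%n%n≡m%n n p) ⟩
      (m % p ℕ.+ n % p) % p         ≡⟨ sym (%-distribˡ-+ m n p) ⟩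
      (m ℕ.+ n) % p                 ∎
      where open ≡-Reasoning

    toℕ-power-rot : ∀ n i → toℕ (power rot n i) ≡ (n ℕ.+ toℕ i) % p
    toℕ-power-rot zero    i = sym (m<n⇒m%n≡m (Fin.toℕ<n i))
    toℕ-power-rot (suc n) i = begin
      toℕ (power rot n (rot i))          ≡⟨ toℕ-power-rot n (rot i) ⟩
      (n ℕ.+ toℕ (rot i)) % p            ≡⟨ cong (λ z → (n ℕ.+ z) % p) (toℕ-rot i) ⟩
      (n ℕ.+ suc (toℕ i) % p) % p        ≡⟨ %-congʳ-+ n (suc (toℕ i)) ⟩
      (n ℕ.+ suc (toℕ i)) % p            ≡⟨ cong (_% p) (ℕ.+-suc n (toℕ i)) ⟩
      (suc n ℕ.+ toℕ i) % p              ∎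
      where open ≡-Reasoning

    power-rot-p : ∀ i → power rot p i ≡ i
    power-rot-p i = Fin.toℕ-injective (begin
      toℕ (power rot p i)   ≡⟨ toℕ-power-rot p i ⟩
      (p ℕ.+ toℕ i) % p     ≡⟨ cong (_% p) (ℕ.+-comm p (toℕ i)) ⟩
      (toℕ i ℕ.+ p) % p     ≡⟨ [m+n]%n≡m%n (toℕ i) p ⟩
      toℕ i % p             ≡⟨ m<n⇒m%n≡m (Fin.toℕ<n i) ⟩
      toℕ i                 ∎)
      where open ≡-Reasoning

    rot⁻¹ : Fin p → Fin p
    rot⁻¹ = power rot q

    rot⁻¹-rot : ∀ i → rot⁻¹ (rot i) ≡ i
    rot⁻¹-rot = power-rot-p

    power-rot-comm : ∀ n i → power rot n (rot i) ≡ rot (power rot n i)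
    power-rot-comm zero    i = refl
    power-rot-comm (suc n) i = power-rot-comm n (rot i)

    rot-rot⁻¹ : ∀ i → rot (rot⁻¹ i) ≡ i
    rot-rot⁻¹ i = trans (sym (power-rot-comm q i)) (power-rot-p i)

    rot-injective : ∀ {i j} → rot i ≡ rot j → i ≡ j
    rot-injective {i} {j} eq = trans (sym (rot⁻¹-rot i)) (trans (cong rot⁻¹ eq) (rot⁻¹-rot j))

    -- Nonzero points are the simplices of the join (ℤ_p)^{*n}, ordered by inclusion.
    Point : ℕ → Set
    Point n = Vec (Maybe (Fin p)) n

    rotMaybe : Maybe (Fin p) → Maybe (Fin p)
    rotMaybe = Maybe.map rot

    rotPoint : ∀ {n} → Point n → Point n
    rotPoint = Vec.map rotMaybe

    power-rotMaybe : ∀ n m → power rotMaybe n m ≡ Maybe.map (power rot n) m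
    power-rotMaybe zero    nothing  = refl
    power-rotMaybe zero    (just i) = refl
    power-rotMaybe (suc n) nothing  = power-rotMaybe n nothing
    power-rotMaybe (suc n) (just i) = power-rotMaybe n (just (rot i))

    power-rotPoint : ∀ n {m} (x : Maybe (Fin p)) (xs : Point m) →
      power rotPoint n (x ∷ xs) ≡ power rotMaybe n x ∷ power rotPoint n xs
    power-rotPoint zero    x xs = refl
    power-rotPoint (suc n) x xs = power-rotPoint n (rotMaybe x) (rotPoint xs)

    power-rotMaybe-p : ∀ m → power rotMaybe p m ≡ m
    power-rotMaybe-p nothing  = power-rotMaybe p nothing
    power-rotMaybe-p (just i) = trans (power-rotMaybe p (just i)) (cong just (power-rot-p i))

    power-rotPoint-p : ∀ {n} (X : Point n) → power rotPoint p X ≡ X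
    power-rotPoint-p []      = power-[] p
      where
      power-[] : ∀ n → power rotPoint n [] ≡ []
      power-[] zero    = refl
      power-[] (suc n) = power-[] n
    power-rotPoint-p (x ∷ X) =
      trans (power-rotPoint p x X) (cong₂ _∷_ (power-rotMaybe-p x) (power-rotPoint-p X))

    _≼_ : ∀ {n} → Point n → Point n → Set
    X ≼ Y = ∀ x {i} → lookup X x ≡ just i → lookup Y x ≡ just i

    Nonzero : ∀ {n} → Point n → Set
    Nonzero X = ∃₂ λ x i → lookup X x ≡ just i

    lookup-rot : ∀ {n} (X : Point n) x → lookup (rotPoint X) x ≡ rotMaybe (lookup X x)
    lookup-rot X x = Vec.lookup-map x rotMaybe X

    lookup-rot⁺ : ∀ {n} (X : Point n) {x i} → lookup X x ≡ just i → lookup (rotPoint X) x ≡ just (rot i)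
    lookup-rot⁺ X {x} eq = trans (lookup-rot X x) (cong rotMaybe eq)

    lookup-rot⁻ : ∀ {n} (X : Point n) {x i} → lookup (rotPoint X) x ≡ just (rot i) → lookup X x ≡ just i
    lookup-rot⁻ X {x} eq with lookup X x | lookup-rot X x
    ... | nothing | eq′ with () ← trans (sym eq) eq′
    ... | just j  | eq′ with trans (sym eq) eq′
    ... | eq″ = cong just (sym (rot-injective (just-injective eq″)))
      where open import Data.Maybe.Properties using (just-injective)

    rot-≼ : ∀ {n} {X Y : Point n} → X ≼ Y → rotPoint X ≼ rotPoint Y
    rot-≼ {X = X} {Y} X≼Y x {i} eq = subst (λ z → lookup (rotPoint Y) x ≡ just z) (rot-rot⁻¹ i)
      (lookup-rot⁺ Y (X≼Y x (lookup-rot⁻ X (trans eq (cong just (sym (rot-rot⁻¹ i)))))))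

    rot-Nonzero : ∀ {n} {X : Point n} → Nonzero X → Nonzero (rotPoint X)
    rot-Nonzero {X = X} (x , i , eq) = x , rot i , lookup-rot⁺ X eq

    -- κ alternates between ν and τ, so that consecutive operators multiply to 0.
    module Alternation {V : Set} (t : V → V) where
      open Rotation t public

      κ : ℕ → Cochain V → Cochain V
      κ 0                   w = w
      κ 1                   w = ν p w
      κ 2                   w = τ w
      κ (suc (suc (suc n))) w = κ (suc n) w

      κ-cong : {P : List V → Set} → (∀ {xs} → P xs → P (map t xs)) → {w w′ : Cochain V} →
               (∀ {xs} → P xs → w xs ≡ w′ xs) → ∀ n {xs} → P xs → κ n w xs ≡ κ n w′ xs
      κ-cong         P-map eq 0                   px = eq px
      κ-cong {P = P} P-map eq 1                   px = ν-cong {P} P-map eq p px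
      κ-cong {P = P} P-map eq 2                   px = τ-cong {P} P-map eq px
      κ-cong {P = P} P-map eq (suc (suc (suc n))) px = κ-cong {P = P} P-map eq (suc n) px

      κ-+ : ∀ n w w′ xs → κ n (λ ys → w ys + w′ ys) xs ≡ κ n w xs + κ n w′ xs
      κ-+ 0                   w w′ xs = refl
      κ-+ 1                   w w′ xs = ν-+ p w w′ xs
      κ-+ 2                   w w′ xs = lem (w (map t xs)) (w′ (map t xs)) (w xs) (w′ xs)
        where
        lem : ∀ a b c d → a + b - (c + d) ≡ (a - c) + (b - d)
        lem = solve-∀
      κ-+ (suc (suc (suc n))) w w′ xs = κ-+ (suc n) w w′ xs

      κ-neg : ∀ n w xs → κ n (λ ys → - w ys) xs ≡ - κ n w xs
      κ-neg 0                   w xs = refl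
      κ-neg 1                   w xs = ν-neg p w xs
      κ-neg 2                   w xs = sym (ℤ.neg-distrib-+ (w (map t xs)) (- w xs))
      κ-neg (suc (suc (suc n))) w xs = κ-neg (suc n) w xs

      κ-minus : ∀ n w w′ xs → κ n (λ ys → w ys - w′ ys) xs ≡ κ n w xs - κ n w′ xs
      κ-minus n w w′ xs = trans (κ-+ n w (λ ys → - w′ ys) xs) (cong (λ z → κ n w xs + z) (κ-neg n w′ xs))

      δ-κ : ∀ n w xs → δ (κ n w) xs ≡ κ n (δ w) xs
      δ-κ 0                   w xs = refl
      δ-κ 1                   w xs = δ-ν p w xs
      δ-κ 2                   w xs = δ-τ w xs
      δ-κ (suc (suc (suc n))) w xs = δ-κ (suc n) w xs

      -- Both composites of `ν p` and `τ` telescope to t^p - 1. The index starts at one because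
      -- `κ 0` is the identity.
      κ-κ : (∀ x → power t p x ≡ x) → ∀ n w xs → κ (suc n) (κ (suc (suc n)) w) xs ≡ 0ℤ
      κ-κ t-p 0             w xs = trans (ν-τ p w xs) (trans (cong (λ z → w z - w xs) (act-id t p t-p xs)) (ℤ.+-inverseʳ (w xs)))
      κ-κ t-p 1             w xs = trans (τ-ν p w xs) (trans (cong (λ z → w z - w xs) (act-id t p t-p xs)) (ℤ.+-inverseʳ (w xs)))
      κ-κ t-p (suc (suc n)) w xs = κ-κ t-p n w xs

    module _ {V V′ : Set} {t : V → V} {t′ : V′ → V′} (f : V → V′) {P : List V → Set}
             (P-map : ∀ {xs} → P xs → P (map t xs))
             (comm : ∀ {xs} → P xs → map f (map t xs) ≡ map t′ (map f xs)) where

      private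
        module R  = Alternation t
        module R′ = Alternation t′

      ν-pullback : ∀ n w {xs} → P xs → R.ν n (w ∘ map f) xs ≡ R′.ν n w (map f xs)
      ν-pullback zero    w {xs} px = refl
      ν-pullback (suc n) w {xs} px = cong (λ z → w (map f xs) + z)
        (trans (ν-pullback n w (P-map px)) (cong (R′.ν n w) (comm px)))

      -- The map has to commute with the action only on lists satisfying `P`, since labellings are
      -- equivariant only at nonzero points.
      κ-pullback : ∀ n w {xs} → P xs → R.κ n (w ∘ map f) xs ≡ R′.κ n w (map f xs)
      κ-pullback 0                   w {xs} px = refl
      κ-pullback 1                   w {xs} px = ν-pullback p w px
      κ-pullback 2                   w {xs} px = cong (λ z → w z - w (map f xs)) (comm px)
      κ-pullback (suc (suc (suc n))) w {xs} px = κ-pullback (suc n) w px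

    module _ {n : ℕ} where
      -- The apex is the vertex with sign zero in a new join factor, `e` leaves that factor empty
      -- and `plus` inserts the vertex. Both the apex and `e X` lie below `plus X`, so flags stay
      -- flags.
      open Cone {Point n} {Point (suc n)} (nothing ∷_) (just Fin.zero ∷_) (just Fin.zero ∷ Vec.replicate n nothing) public

      -- Enumerates the lists at which `prism w` evaluates `w`, so that properties of these lists
      -- can be proved by induction.
      data Prism : List (Point n) → List (Point (suc n)) → Set where
        base : ∀ {X Xs} → Prism (X ∷ Xs) ((nothing ∷ X) ∷ map (just Fin.zero ∷_) (X ∷ Xs))
        step : ∀ {X Xs Zs} → Prism Xs Zs → Prism (X ∷ Xs) ((nothing ∷ X) ∷ Zs)

      prism-cong : ∀ {w w′ : Cochain (Point (suc n))} Xs → (∀ {Zs} → Prism Xs Zs → w Zs ≡ w′ Zs) →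
                   prism w Xs ≡ prism w′ Xs
      prism-cong []       eq = refl
      prism-cong (X ∷ Xs) eq = cong₂ _-_ (eq base) (prism-cong Xs (eq ∘ step))

      prism-All : ∀ {P : Point n → Set} {Q : Point (suc n) → Set} →
                  (∀ {X} → P X → Q (nothing ∷ X) × Q (just Fin.zero ∷ X)) →
                  ∀ {Xs Zs} → Prism Xs Zs → All P Xs → All Q Zs
      prism-All f base     (p ∷ ps) = proj₁ (f p) ∷ proj₂ (f p) ∷ All.map⁺ (All.map (proj₂ ∘ f) ps)
      prism-All f (step z) (p ∷ ps) = proj₁ (f p) ∷ prism-All f z ps

    ∷-≼ : ∀ {n a} {X Y : Point n} → X ≼ Y → (a ∷ X) ≼ (a ∷ Y)
    ∷-≼ X≼Y Fin.zero    eq = eq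
    ∷-≼ X≼Y (Fin.suc x) eq = X≼Y x eq

    nothing-≼ : ∀ {n b} {X Y : Point n} → X ≼ Y → (nothing ∷ X) ≼ (b ∷ Y)
    nothing-≼ X≼Y (Fin.suc x) eq = X≼Y x eq

    -- Flags of n nonempty simplices, that is, ordered top-dimensional simplices of the barycentric
    -- subdivision of the join. As `_≼_` is reflexive, degenerate flags are included.
    Chain : ∀ n → List (Point n) → Set
    Chain n Xs = length Xs ≡ n × AllPairs _≼_ Xs × All Nonzero Xs

    Chain-rot : ∀ {n Xs} → Chain n Xs → Chain n (map rotPoint Xs)
    Chain-rot {Xs = Xs} (len , ps , nz) =
      trans (List.length-map rotPoint Xs) len ,
      AllPairs.map⁺ (AllPairs.map (λ {X} {Y} → rot-≼ {X = X} {Y}) ps) ,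
      All.map⁺ (All.map (λ {X} → rot-Nonzero {X = X}) nz)

    private
      Nonzero-∷ : ∀ {n a} {X : Point n} → Nonzero X → Nonzero (a ∷ X)
      Nonzero-∷ (x , i , eq) = Fin.suc x , i , eq

      length-prism : ∀ {n} {Xs : List (Point n)} {Zs} → Prism Xs Zs → length Zs ≡ suc (length Xs)
      length-prism (base {Xs = Xs}) = cong (λ z → suc (suc z)) (List.length-map _ Xs)
      length-prism (step z)         = cong suc (length-prism z)

      AllPairs-prism : ∀ {n} {Xs : List (Point n)} {Zs} → Prism Xs Zs → AllPairs _≼_ Xs → AllPairs _≼_ Zs
      AllPairs-prism (base {X = X}) (p ∷ ps) =
        ((nothing-≼ {X = X} {X} λ _ eq → eq) ∷ All.map⁺ (All.map (λ {Y} → nothing-≼ {X = X} {Y}) p)) ∷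
        AllPairs.map⁺ (AllPairs.map (λ {X} {Y} → ∷-≼ {X = X} {Y}) (p ∷ ps))
      AllPairs-prism (step {X = X} z) (p ∷ ps) =
        prism-All (λ {Y} X≼Y → nothing-≼ {X = X} {Y} X≼Y , nothing-≼ {X = X} {Y} X≼Y) z p ∷ AllPairs-prism z ps

    Chain-prism : ∀ {n Xs Zs} → Chain n Xs → Prism Xs Zs → Chain (suc n) Zs
    Chain-prism (len , ps , nz) z =
      trans (length-prism z) (cong suc len) ,
      AllPairs-prism z ps ,
      prism-All (λ nz → Nonzero-∷ nz , Nonzero-∷ nz) z nz

    Chain-cone : ∀ {n Xs} → Chain n Xs →
                 Chain (suc n) ((just Fin.zero ∷ Vec.replicate n nothing) ∷ map (just Fin.zero ∷_) Xs)
    Chain-cone {n} {Xs} (len , ps , nz) =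
      cong suc (trans (List.length-map _ Xs) len) ,
      All.map⁺ (All.map (λ {X} _ → below X) nz) ∷ AllPairs.map⁺ (AllPairs.map (λ {X} {Y} → ∷-≼ {X = X} {Y}) ps) ,
      (Fin.zero , Fin.zero , refl) ∷ All.map⁺ (All.map Nonzero-∷ nz)
      where
      below : ∀ X → (just Fin.zero ∷ Vec.replicate n nothing) ≼ (just Fin.zero ∷ X)
      below X Fin.zero    eq = eq
      below X (Fin.suc x) eq with () ← trans (sym (Vec.lookup-replicate x nothing)) eq

    module Act n = Alternation (rotPoint {n})

    -- H n evaluates cochains on the chain h_n given by h₀ = [] and h_{n+1} = cone (κ h_n); modulo p
    -- the boundary of h_{n+1} is κ h_n.
    H : ∀ n → Cochain (Point n) → ℤ
    H zero    w = w []
    H (suc n) w = H n (Act.κ n n (cone w))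

    -- The chain evaluated by `H n` is supported on flags, because cones, prisms and rotations
    -- preserve them. Everything assumed of labellings concerns nonzero comparable points and
    -- becomes applicable through this.
    H-cong : ∀ n {w w′} → (∀ {Xs} → Chain n Xs → w Xs ≡ w′ Xs) → H n w ≡ H n w′
    H-cong zero    eq = eq (refl , [] , [])
    H-cong (suc n) {w} {w′} eq = H-cong n (Act.κ-cong n {P = Chain n} Chain-rot cone-eq n)
      where
      cone-eq : ∀ {Xs} → Chain n Xs → cone w Xs ≡ cone w′ Xs
      cone-eq {Xs} c = cong₂ _-_ (eq (Chain-cone c)) (prism-cong Xs (λ z → eq (Chain-prism c z)))

    H-minus : ∀ n w w′ → H n (λ xs → w xs - w′ xs) ≡ H n w - H n w′
    H-minus zero    w w′ = refl
    H-minus (suc n) w w′ = trans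
      (H-cong n λ {Xs} c → trans
        (Act.κ-cong n {P = Chain n} Chain-rot
          (λ {Ys} _ → trans (cong (λ z → w (a Ys) - w′ (a Ys) - z) (prism-minus w w′ Ys))
                            (lem (w (a Ys)) (w′ (a Ys)) (prism w Ys) (prism w′ Ys))) n c)
        (Act.κ-minus n n (cone w) (cone w′) Xs))
      (H-minus n _ _)
      where
      a : List (Point n) → List (Point (suc n))
      a Ys = (just Fin.zero ∷ Vec.replicate n nothing) ∷ map (just Fin.zero ∷_) Ys
      lem : ∀ a b c d → a - b - (c - d) ≡ (a - c) - (b - d)
      lem = solve-∀

    H-0 : ∀ n {w} → (∀ {Xs} → Chain n Xs → w Xs ≡ 0ℤ) → H n w ≡ 0ℤ
    H-0 n {w} eq = begin
      H n w                                  ≡⟨ H-cong n (λ c → eq c) ⟩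
      H n (λ xs → 0ℤ - 0ℤ)                   ≡⟨ H-minus n (λ _ → 0ℤ) (λ _ → 0ℤ) ⟩
      H n (λ _ → 0ℤ) - H n (λ _ → 0ℤ)        ≡⟨ ℤ.+-inverseʳ (H n (λ _ → 0ℤ)) ⟩
      0ℤ                                     ∎
      where open ≡-Reasoning

    infix 4 _≈_
    record _≈_ (a b : ℤ) : Set where
      constructor mod-p
      field p∣difference : + p ∣ℤ (a - b)

    ≈-reflexive : ∀ {a b} → a ≡ b → a ≈ b
    ≈-reflexive {a} refl = mod-p (subst (+ p ∣ℤ_) (sym (ℤ.+-inverseʳ a)) (divides 0ℤ refl))

    ≈-trans : ∀ {a b c} → a ≈ b → b ≈ c → a ≈ c
    ≈-trans {a} {b} {c} (mod-p ab) (mod-p bc) = mod-p (subst (+ p ∣ℤ_) (lem a b c) (ℤ∣.∣m∣n⇒∣m+n ab bc))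
      where
      lem : ∀ a b c → a - b + (b - c) ≡ a - c
      lem = solve-∀

    -- The boundary relation, with the lower chain placed in the face where the new factor is empty.
    -- By `cone-homotopy` the boundary of a cone over c is c minus the cone over ∂c. For c = κ h_n
    -- the latter boundary is κ applied to κ h_{n-1}, which `H-κκ` kills.
    H-δ : ∀ n (w : Cochain (Point (suc n))) → H (suc n) (δ w) ≈ H n (Act.κ n n (w ∘ map (nothing ∷_)))
    H-κκ : ∀ n (w : Cochain (Point n)) → H n (Act.κ n n (Act.κ n (suc n) w)) ≈ 0ℤ

    H-δ n w = ≈-trans (≈-reflexive eq) (rest n w)
      where
      eq : H (suc n) (δ w) ≡ H n (Act.κ n n (w ∘ map (nothing ∷_))) - H n (Act.κ n n (δ (cone w)))
      eq = trans
        (H-cong n λ {Xs} c → trans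
          (Act.κ-cong n {P = Chain n} Chain-rot (λ {Ys} _ → cone-homotopy w Ys) n c)
          (Act.κ-minus n n (w ∘ map (nothing ∷_)) (δ (cone w)) Xs))
        (H-minus n _ _)
      minus : ∀ {a b} → b ≈ 0ℤ → (a - b) ≈ a
      minus {a} {b} (mod-p b≈0) = mod-p (subst (+ p ∣ℤ_) (lem a b) (ℤ∣.∣m⇒∣-m b≈0))
        where
        lem : ∀ a b → - (b - 0ℤ) ≡ a - b - a
        lem = solve-∀
      rest : ∀ n w → (H n (Act.κ n n (w ∘ map (nothing ∷_))) - H n (Act.κ n n (δ (cone w))))
                     ≈ H n (Act.κ n n (w ∘ map (nothing ∷_)))
      rest zero    w = minus {w []} {0ℤ} (≈-reflexive refl)
      rest (suc n) w = minus (≈-trans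
        (≈-reflexive (H-cong (suc n) λ {Xs} _ → sym (Act.δ-κ (suc n) (suc n) (cone w) Xs)))
        (≈-trans (H-δ n (Act.κ (suc n) (suc n) (cone w)))
        (≈-trans
          (≈-reflexive (H-cong n (Act.κ-cong n {P = Chain n} Chain-rot
            (λ c → sym (κ-pullback (nothing ∷_) {P = λ _ → ⊤} (λ _ → tt) (λ {Ys} _ → comm Ys) (suc n) (cone w) tt)) n)))
          (H-κκ n (cone w ∘ map (nothing ∷_))))))
        where
        comm : ∀ Ys → map (nothing ∷_) (map rotPoint Ys) ≡ map rotPoint (map (nothing ∷_) Ys)
        comm Ys = trans (sym (List.map-∘ Ys)) (List.map-∘ Ys)

    -- The only source of the modulus: `κ 0` is the identity, and the norm on the empty list is
    -- multiplication by p. In higher degrees the composite is exactly zero.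
    H-κκ zero    w = ≈-trans (≈-reflexive (Act.ν-[] 0 p w))
      (mod-p (subst (+ p ∣ℤ_) (sym (ℤ.+-identityʳ (+ p * w []))) (ℤ∣.∣m⇒∣m*n (w []) ℤ∣.∣-refl)))
    H-κκ (suc n) w = ≈-reflexive (H-0 (suc n) λ {Xs} _ → Act.κ-κ (suc n) power-rotPoint-p n w Xs)

-- Dual cochains of the target and the Tucker lemma

module TuckerLemma where

  open Cochains
  open JoinChains
  open import Data.Nat as ℕ using (ℕ; zero; suc; _⊓_)
  import Data.Nat.Properties as ℕ
  open import Data.Nat.DivMod using (_%_; _/_; m%n<n; m<n⇒m%n≡m; n%n≡0; [m+kn]%n≡m%n; m≡m%n+[m/n]*n)
  import Data.Nat.Divisibility as ℕ∣
  open import Data.Integer using (ℤ; +_; 0ℤ; 1ℤ; _+_; _*_; _-_; -_)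
  import Data.Integer.Properties as ℤ
  open import Data.Integer.Tactic.RingSolver using (solve-∀)
  open import Data.Integer.Divisibility.Signed as ℤ∣ using () renaming (_∣_ to _∣ℤ_)
  open import Data.Fin as Fin using (Fin; toℕ)
  import Data.Fin.Properties as Fin
  open import Data.List as List using (List; []; _∷_; map; length; _++_; foldr)
  import Data.List.Properties as List
  open import Data.List.Membership.Propositional using (_∈_)
  open import Data.List.Membership.Propositional.Properties using (∈-map⁻; ∈-map⁺; ∈-lookup)
  open import Data.List.Relation.Binary.Subset.Propositional using (_⊆_)
  open import Data.List.Relation.Unary.Any using (here; there)
  open import Data.List.Relation.Unary.All as All using (All; []; _∷_)
  open import Data.List.Relation.Unary.AllPairs using (AllPairs; []; _∷_)
  import Data.List.Relation.Unary.All.Properties as All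
  open import Data.Maybe using (nothing)
  open import Data.Vec using (lookup; []; _∷_)
  open import Data.Product using (∃; _×_; _,_; proj₁; proj₂)
  open import Data.Sum using (inj₁; inj₂)
  open import Data.Unit using (⊤; tt)
  open import Function using (_∘_)
  open import Relation.Nullary using (¬_)
  open import Relation.Binary.PropositionalEquality

  alternating-lookup : ∀ {V : Set} {w : Cochain V} → Alternating w → ∀ σ {i j} → i Fin.< j →
                       List.lookup σ i ≡ List.lookup σ j → w σ ≡ 0ℤ
  alternating-lookup {w = w} alt (a ∷ σ) {Fin.zero} {Fin.suc j} _ eq =
    alternating-repeat {w = w} alt (subst (_∈ σ) (sym eq) (∈-lookup j))
  alternating-lookup {w = w} alt (a ∷ σ) {Fin.suc i} {Fin.suc j} (ℕ.s≤s i<j) eq =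
    alternating-lookup {w = cofactor a w} (cofactor-alternating a {w} alt) σ i<j eq

  module Label (q M : ℕ) where
    open Sign q

    Label : Set
    Label = Fin p × Fin M

    rotLabel : Label → Label
    rotLabel (ε , v) = rot ε , v

    open Alternation rotLabel

    power-rotLabel : ∀ n ε v → power rotLabel n (ε , v) ≡ (power rot n ε , v)
    power-rotLabel zero    ε v = refl
    power-rotLabel (suc n) ε v = power-rotLabel n (rot ε) v

    power-rotLabel-p : ∀ a → power rotLabel p a ≡ a
    power-rotLabel-p (ε , v) = trans (power-rotLabel p ε v) (cong (_, v) (power-rot-p ε))

    -- The simplices of the target complex (ℤ_p)^{*M}: each value carries at most one sign.
    Consistent : List Label → Set
    Consistent σ = ∀ {a b} → a ∈ σ → b ∈ σ → proj₂ a ≡ proj₂ b → a ≡ b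

    Consistent-⊆ : ∀ {σ ρ} → ρ ⊆ σ → Consistent σ → Consistent ρ
    Consistent-⊆ ρ⊆σ c a∈ b∈ = c (ρ⊆σ a∈) (ρ⊆σ b∈)

    Consistent-rot : ∀ {σ} → Consistent σ → Consistent (map rotLabel σ)
    Consistent-rot c a∈ b∈ eq with ∈-map⁻ rotLabel a∈ | ∈-map⁻ rotLabel b∈
    ... | a′ , a′∈ , refl | b′ , b′∈ , refl = cong rotLabel (c a′∈ b′∈ eq)

    -- Orders labels by value first, while the sign remains readable as the remainder modulo p. A
    -- least key thus names a least value together with its sign.
    key : Label → ℕ
    key (ε , v) = toℕ ε ℕ.+ toℕ v ℕ.* p

    key-% : ∀ ε v → key (ε , v) % p ≡ toℕ ε
    key-% ε v = trans ([m+kn]%n≡m%n (toℕ ε) (toℕ v) p) (m<n⇒m%n≡m (Fin.toℕ<n ε))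

    key-≤⇒value-≤ : ∀ {a b} → key a ℕ.≤ key b → toℕ (proj₂ a) ℕ.≤ toℕ (proj₂ b)
    key-≤⇒value-≤ {ε , v} {ε′ , v′} le = ℕ.≮⇒≥ λ v′<v → ℕ.<⇒≱ (begin-strict
      toℕ ε′ ℕ.+ toℕ v′ ℕ.* p   <⟨ ℕ.+-monoˡ-< (toℕ v′ ℕ.* p) (Fin.toℕ<n ε′) ⟩
      suc (toℕ v′) ℕ.* p        ≤⟨ ℕ.*-monoˡ-≤ p v′<v ⟩
      toℕ v ℕ.* p               ≤⟨ ℕ.m≤n+m _ (toℕ ε) ⟩
      toℕ ε ℕ.+ toℕ v ℕ.* p     ∎) le
      where open ℕ.≤-Reasoning

    key-bound : ∀ a → key a ℕ.≤ M ℕ.* p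
    key-bound (ε , v) = begin
      toℕ ε ℕ.+ toℕ v ℕ.* p   ≤⟨ ℕ.+-monoˡ-≤ (toℕ v ℕ.* p) (ℕ.<⇒≤ (Fin.toℕ<n ε)) ⟩
      suc (toℕ v) ℕ.* p       ≤⟨ ℕ.*-monoˡ-≤ p (Fin.toℕ<n v) ⟩
      M ℕ.* p                 ∎
      where open ℕ.≤-Reasoning

    -- The default `M * p` bounds all keys, so it never beats an entry. Being a minimum, the result
    -- ignores the order of the list, which keeps the cochains built from it alternating.
    minKey : List Label → ℕ
    minKey = foldr (λ a m → key a ⊓ m) (M ℕ.* p)

    minKey-≤ : ∀ {σ a} → a ∈ σ → minKey σ ℕ.≤ key a
    minKey-≤ {a ∷ σ} (here refl) = ℕ.m⊓n≤m (key a) (minKey σ)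
    minKey-≤ {b ∷ σ} (there a∈σ) = ℕ.≤-trans (ℕ.m⊓n≤n (key b) (minKey σ)) (minKey-≤ a∈σ)

    minKey-attained : ∀ a σ → ∃ λ b → b ∈ a ∷ σ × minKey (a ∷ σ) ≡ key b
    minKey-attained a []      = a , here refl , ℕ.m≤n⇒m⊓n≡m (key-bound a)
    minKey-attained a (b ∷ σ) with minKey-attained b σ | ℕ.⊓-sel (key a) (minKey (b ∷ σ))
    ... | _             | inj₁ eq = a , here refl , eq
    ... | c , c∈ , eq′  | inj₂ eq = c , there c∈ , trans eq eq′

    minKey-swap : ∀ xs a b ys → minKey (xs ++ a ∷ b ∷ ys) ≡ minKey (xs ++ b ∷ a ∷ ys)
    minKey-swap [] a b ys = begin
      key a ⊓ (key b ⊓ minKey ys)   ≡⟨ sym (ℕ.⊓-assoc (key a) (key b) (minKey ys)) ⟩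
      key a ⊓ key b ⊓ minKey ys     ≡⟨ cong (_⊓ minKey ys) (ℕ.⊓-comm (key a) (key b)) ⟩
      key b ⊓ key a ⊓ minKey ys     ≡⟨ ℕ.⊓-assoc (key b) (key a) (minKey ys) ⟩
      key b ⊓ (key a ⊓ minKey ys)   ∎
      where open ≡-Reasoning
    minKey-swap (x ∷ xs) a b ys = cong (key x ⊓_) (minKey-swap xs a b ys)

    -- Equivariant on consistent lists, so it makes the action on them free.
    sign : List Label → ℕ
    sign σ = minKey σ % p

    sign<p : ∀ σ → sign σ ℕ.< p
    sign<p σ = m%n<n (minKey σ) p

    -- Rotation preserves values, hence the least value. In a consistent list only one label carries
    -- that value, so the minimum before and after rotation comes from the same label, whose sign
    -- moves by one.
    sign-rot : ∀ a σ → Consistent (a ∷ σ) → sign (map rotLabel (a ∷ σ)) ≡ suc (sign (a ∷ σ)) % p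
    sign-rot a σ c
      with minKey-attained a σ | minKey-attained (rotLabel a) (map rotLabel σ)
    ... | (ε , v) , b∈ , eq | b , b∈′ , eq′ with ∈-map⁻ rotLabel {xs = a ∷ σ} b∈′
    ... | (ε′ , v′) , c∈ , refl = begin
      minKey (map rotLabel (a ∷ σ)) % p        ≡⟨ cong (_% p) eq′ ⟩
      key (rot ε′ , v′) % p                    ≡⟨ key-% (rot ε′) v′ ⟩
      toℕ (rot ε′)                             ≡⟨ cong (toℕ ∘ rot ∘ proj₁) same ⟩
      toℕ (rot ε)                              ≡⟨ toℕ-rot ε ⟩
      suc (toℕ ε) % p                          ≡⟨ cong (λ z → suc z % p) (sym (key-% ε v)) ⟩
      suc (key (ε , v) % p) % p                ≡⟨ cong (λ z → suc (z % p) % p) (sym eq) ⟩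
      suc (minKey (a ∷ σ) % p) % p             ∎
      where
      open ≡-Reasoning
      v≤v′ : toℕ v ℕ.≤ toℕ v′
      v≤v′ = key-≤⇒value-≤ {ε , v} {ε′ , v′} (subst (ℕ._≤ _) eq (minKey-≤ c∈))
      v′≤v : toℕ v′ ℕ.≤ toℕ v
      v′≤v = key-≤⇒value-≤ {rot ε′ , v′} {rot ε , v}
        (subst (ℕ._≤ _) eq′ (minKey-≤ (∈-map⁺ rotLabel b∈)))
      same : (ε′ , v′) ≡ (ε , v)
      same = c c∈ b∈ (Fin.toℕ-injective (ℕ.≤-antisym v′≤v v≤v′))

    -- Right inverses of ν and τ on the cochains annihilated by τ and ν respectively.
    ν⁻¹ τ⁻¹ : Cochain Label → Cochain Label
    ν⁻¹ z σ = + (suc (sign σ) / p) * z σ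
    τ⁻¹ z σ = - ν (p ℕ.∸ sign σ) z σ

    module _ (z : Cochain Label) (z[] : z [] ≡ 0ℤ) where

      module _ (τz : ∀ {σ} → Consistent σ → τ z σ ≡ 0ℤ) where

        private
          z-rot : ∀ {σ} → Consistent σ → z (map rotLabel σ) ≡ z σ
          z-rot {σ} c = ℤ.i-j≡0⇒i≡j (z (map rotLabel σ)) (z σ) (τz c)

          carry : ∀ j → + p * + (suc j / p) ≡ 1ℤ + + j - + (suc j % p)
          carry j = begin
            + p * + (suc j / p)                                        ≡⟨ lem (+ p) (+ (suc j / p)) (+ (suc j % p)) ⟩
            + (suc j % p) + + (suc j / p) * + p - + (suc j % p)        ≡⟨ cong (λ x → + (suc j % p) + x - + (suc j % p)) (sym (ℤ.pos-* (suc j / p) p)) ⟩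
            + (suc j % p ℕ.+ suc j / p ℕ.* p) - + (suc j % p)          ≡⟨ cong (λ x → + x - + (suc j % p)) (sym (m≡m%n+[m/n]*n (suc j) p)) ⟩
            1ℤ + + j - + (suc j % p)                                   ∎
            where
            open ≡-Reasoning
            lem : ∀ a b c → a * b ≡ c + b * a - c
            lem = solve-∀

          -- The quotient in `ν⁻¹` is the carry when the sign wraps around, and by `carry` p times
          -- it is one plus the drop of the sign. As `z` is invariant, the sum telescopes. After p
          -- rotations the sign is back and exactly one carry has occurred.
          telescope : ∀ n a σ → Consistent (a ∷ σ) →
            + p * ν n (ν⁻¹ z) (a ∷ σ) ≡ (+ n + + sign (a ∷ σ) - + sign (act n (a ∷ σ))) * z (a ∷ σ)
          telescope zero    a σ c = lem (+ p) (+ sign (a ∷ σ)) (z (a ∷ σ))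
            where
            lem : ∀ a b c → a * 0ℤ ≡ (0ℤ + b - b) * c
            lem = solve-∀
          telescope (suc n) a σ c = begin
            + p * (+ (suc j / p) * z σ⁺ + ν n (ν⁻¹ z) (map rotLabel σ⁺))
              ≡⟨ lem₁ (+ p) (+ (suc j / p)) (z σ⁺) (ν n (ν⁻¹ z) (map rotLabel σ⁺)) ⟩
            + p * + (suc j / p) * z σ⁺ + + p * ν n (ν⁻¹ z) (map rotLabel σ⁺)
              ≡⟨ cong₂ (λ x y → x * z σ⁺ + y) (carry j)
                   (telescope n (rotLabel a) (map rotLabel σ) (Consistent-rot c)) ⟩
            (1ℤ + + j - + (suc j % p)) * z σ⁺ + (+ n + + sign (map rotLabel σ⁺) - + k) * z (map rotLabel σ⁺)
              ≡⟨ cong₂ (λ x y → (1ℤ + + j - + (suc j % p)) * z σ⁺ + (+ n + + x - + k) * y)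
                   (sign-rot a σ c) (z-rot c) ⟩
            (1ℤ + + j - + (suc j % p)) * z σ⁺ + (+ n + + (suc j % p) - + k) * z σ⁺
              ≡⟨ lem₂ (+ j) (+ (suc j % p)) (+ n) (+ k) (z σ⁺) ⟩
            (+ suc n + + j - + k) * z σ⁺ ∎
            where
            open ≡-Reasoning
            σ⁺ = a ∷ σ
            j = sign σ⁺
            k = sign (act n (map rotLabel σ⁺))
            lem₁ : ∀ a b c d → a * (b * c + d) ≡ a * b * c + a * d
            lem₁ = solve-∀
            lem₂ : ∀ j j′ n k z → (1ℤ + j - j′) * z + (n + j′ - k) * z ≡ (1ℤ + n + j - k) * z
            lem₂ = solve-∀

        ν-ν⁻¹ : ∀ {σ} → Consistent σ → ν p (ν⁻¹ z) σ ≡ z σ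
        ν-ν⁻¹ {[]} c = trans (ν-[] p (ν⁻¹ z)) (trans (cong (λ x → + p * (+ (suc (sign []) / p) * x)) z[])
          (trans (lem (+ p) (+ (suc (sign []) / p))) (sym z[])))
          where
          lem : ∀ a b → a * (b * 0ℤ) ≡ 0ℤ
          lem = solve-∀
        ν-ν⁻¹ {a ∷ σ} c = ℤ.*-cancelˡ-≡ (+ p) _ _ (begin
          + p * ν p (ν⁻¹ z) (a ∷ σ)
            ≡⟨ telescope p a σ c ⟩
          (+ p + + sign (a ∷ σ) - + sign (act p (a ∷ σ))) * z (a ∷ σ)
            ≡⟨ cong (λ x → (+ p + + sign (a ∷ σ) - + sign x) * z (a ∷ σ)) (act-id rotLabel p power-rotLabel-p (a ∷ σ)) ⟩
          (+ p + + sign (a ∷ σ) - + sign (a ∷ σ)) * z (a ∷ σ)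
            ≡⟨ cong (_* z (a ∷ σ)) (lem (+ p) (+ sign (a ∷ σ))) ⟩
          + p * z (a ∷ σ) ∎)
          where
          open ≡-Reasoning
          lem : ∀ a b → a + b - b ≡ a
          lem = solve-∀

      module _ (νz : ∀ {σ} → Consistent σ → ν p z σ ≡ 0ℤ) where

        -- Up to the sign, `τ⁻¹ z` sums `z` from `σ` to the end of its orbit, where the orbit starts
        -- at `sign` zero. Consecutive sums differ by `z σ`. At the wrap-around the new sum runs
        -- over a whole orbit and vanishes by `νz`.
        τ-τ⁻¹ : ∀ {σ} → Consistent σ → τ (τ⁻¹ z) σ ≡ z σ
        τ-τ⁻¹ {[]} c = trans (ℤ.+-inverseʳ (τ⁻¹ z [])) (sym z[])
        τ-τ⁻¹ {a ∷ σ} c with ℕ.m≤n⇒m<n∨m≡n (sign<p (a ∷ σ))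
        ... | inj₁ j⁺<p = begin
          - ν (p ℕ.∸ sign (map rotLabel σ⁺)) z (map rotLabel σ⁺) - - ν (p ℕ.∸ j) z σ⁺
            ≡⟨ cong₂ (λ x y → - ν (p ℕ.∸ x) z (map rotLabel σ⁺) - - ν y z σ⁺)
                 (trans (sign-rot a σ c) (m<n⇒m%n≡m j⁺<p)) (ℕ.+-∸-assoc 1 {q} {j} (ℕ.s≤s⁻¹ (ℕ.<⇒≤ j⁺<p))) ⟩
          - ν (q ℕ.∸ j) z (map rotLabel σ⁺) - - (z σ⁺ + ν (q ℕ.∸ j) z (map rotLabel σ⁺))
            ≡⟨ lem (ν (q ℕ.∸ j) z (map rotLabel σ⁺)) (z σ⁺) ⟩
          z σ⁺ ∎
          where
          open ≡-Reasoning
          σ⁺ = a ∷ σ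
          j = sign σ⁺
          lem : ∀ a b → - a - - (b + a) ≡ b
          lem = solve-∀
        ... | inj₂ j⁺≡p = begin
          - ν (p ℕ.∸ sign (map rotLabel σ⁺)) z (map rotLabel σ⁺) - - ν (p ℕ.∸ j) z σ⁺
            ≡⟨ cong₂ (λ x y → - ν (p ℕ.∸ x) z (map rotLabel σ⁺) - - ν y z σ⁺)
                 (trans (sign-rot a σ c) (trans (cong (_% p) j⁺≡p) (n%n≡0 p)))
                 (trans (cong (ℕ._∸ j) (sym j⁺≡p)) (ℕ.m+n∸n≡m 1 j)) ⟩
          - ν p z (map rotLabel σ⁺) - - (z σ⁺ + 0ℤ)
            ≡⟨ cong (λ x → - x - - (z σ⁺ + 0ℤ)) (νz (Consistent-rot c)) ⟩
          - 0ℤ - - (z σ⁺ + 0ℤ)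
            ≡⟨ lem (z σ⁺) ⟩
          z σ⁺ ∎
          where
          open ≡-Reasoning
          σ⁺ = a ∷ σ
          j = sign σ⁺
          lem : ∀ b → - 0ℤ - - (b + 0ℤ) ≡ b
          lem = solve-∀

    ν-alternating : ∀ n {z} → Alternating z → Alternating (ν n z)
    ν-alternating zero    alt xs a b ys = refl
    ν-alternating (suc n) {z} alt xs a b ys = trans
      (cong₂ _+_ (alt xs a b ys)
        (trans (cong (ν n z) (List.map-++ rotLabel xs (a ∷ b ∷ ys)))
        (trans (ν-alternating n {z} alt (map rotLabel xs) (rotLabel a) (rotLabel b) (map rotLabel ys))
               (cong (λ σ → - ν n z σ) (sym (List.map-++ rotLabel xs (b ∷ a ∷ ys)))))))
      (sym (ℤ.neg-distrib-+ (z (xs ++ b ∷ a ∷ ys)) _))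

    ν⁻¹-alternating : ∀ {z} → Alternating z → Alternating (ν⁻¹ z)
    ν⁻¹-alternating {z} alt xs a b ys = trans
      (cong₂ (λ m x → + (suc (m % p) / p) * x) (minKey-swap xs a b ys) (alt xs a b ys))
      (sym (ℤ.neg-distribʳ-* (+ (suc (sign (xs ++ b ∷ a ∷ ys)) / p)) (z (xs ++ b ∷ a ∷ ys))))

    τ⁻¹-alternating : ∀ {z} → Alternating z → Alternating (τ⁻¹ z)
    τ⁻¹-alternating {z} alt xs a b ys = cong -_ (trans
      (cong (λ m → ν (p ℕ.∸ m % p) z (xs ++ a ∷ b ∷ ys)) (minKey-swap xs a b ys))
      (ν-alternating (p ℕ.∸ sign (xs ++ b ∷ a ∷ ys)) {z} alt xs a b ys))

    κ⁻¹ : ℕ → Cochain Label → Cochain Label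
    κ⁻¹ 0                   z = z
    κ⁻¹ 1                   z = ν⁻¹ z
    κ⁻¹ 2                   z = τ⁻¹ z
    κ⁻¹ (suc (suc (suc n))) z = κ⁻¹ (suc n) z

    κ⁻¹-alternating : ∀ n {z} → Alternating z → Alternating (κ⁻¹ n z)
    κ⁻¹-alternating 0                   alt = alt
    κ⁻¹-alternating 1                   {z} alt = ν⁻¹-alternating {z} alt
    κ⁻¹-alternating 2                   {z} alt = τ⁻¹-alternating {z} alt
    κ⁻¹-alternating (suc (suc (suc n))) {z} alt = κ⁻¹-alternating (suc n) {z} alt

    -- Exactness of the periodic sequence of `ν` and `τ`: the kernel of each operator is the image
    -- of the next. This expresses the freeness of the action on nonempty consistent lists.
    κ-κ⁻¹ : ∀ n z → z [] ≡ 0ℤ → (∀ {σ} → Consistent σ → κ (suc n) z σ ≡ 0ℤ) →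
            ∀ {σ} → Consistent σ → κ (suc (suc n)) (κ⁻¹ (suc (suc n)) z) σ ≡ z σ
    κ-κ⁻¹ 0             z z[] eq c = τ-τ⁻¹ z z[] eq c
    κ-κ⁻¹ 1             z z[] eq c = ν-ν⁻¹ z z[] eq c
    κ-κ⁻¹ (suc (suc n)) z z[] eq c = κ-κ⁻¹ n z z[] eq c

    -- Solutions of κ U_{n+1} = δ U_n starting from the augmentation.
    U : ℕ → Cochain Label
    U zero    []      = 1ℤ
    U zero    (_ ∷ _) = 0ℤ
    U (suc n) σ       = κ⁻¹ (suc n) (δ (U n)) σ

    U-alternating : ∀ n → Alternating (U n)
    U-alternating zero    []       a b ys = refl
    U-alternating zero    (x ∷ xs) a b ys = refl
    U-alternating (suc n) = κ⁻¹-alternating (suc n) {δ (U n)} (δ-alternating {w = U n} (U-alternating n))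

    -- The operator can be inverted since the preceding one kills `δ (U n)`: it commutes with `δ`
    -- and turns `U n` into the coboundary of its predecessor, and `δδ` is zero. At the start, `τ`
    -- kills the augmentation because that is invariant.
    κ-U : ∀ n {σ} → Consistent σ → κ (suc n) (U (suc n)) σ ≡ δ (U n) σ
    κ-U zero c = ν-ν⁻¹ (δ (U 0)) refl (λ {σ} _ → trans (sym (δ-τ (U 0) σ)) (trans (δ-cong-≗ τU₀ σ) (δ-0 σ))) c
      where
      τU₀ : ∀ σ → τ (U 0) σ ≡ 0ℤ
      τU₀ []      = refl
      τU₀ (_ ∷ _) = refl
    κ-U (suc n) = κ-κ⁻¹ n (δ (U (suc n))) refl λ {σ} c → begin
      κ (suc n) (δ (U (suc n))) σ   ≡⟨ sym (δ-κ (suc n) (U (suc n)) σ) ⟩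
      δ (κ (suc n) (U (suc n))) σ   ≡⟨ δ-cong σ (λ ρ⊆σ → κ-U n (Consistent-⊆ ρ⊆σ c)) ⟩
      δ (δ (U n)) σ                 ≡⟨ δδ (U n) σ ⟩
      0ℤ                            ∎
      where open ≡-Reasoning

    -- Among more than `M` labels two share a value, so by consistency they coincide, and
    -- alternation does the rest.
    long⇒0 : ∀ {w} → Alternating w → ∀ {σ} → M ℕ.< length σ → Consistent σ → w σ ≡ 0ℤ
    long⇒0 {w} alt {σ} M<∣σ∣ c with Fin.pigeonhole M<∣σ∣ (proj₂ ∘ List.lookup σ)
    ... | i , j , i<j , eq = alternating-lookup {w = w} alt σ i<j (c (∈-lookup i) (∈-lookup j) eq)

    -- An equivariant simplicial map from the barycentric subdivision of (ℤ_p)^{*N} to (ℤ_p)^{*M}.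
    -- The empty simplex gets a label as well, which is left unconstrained.
    record Labelling (N : ℕ) : Set where
      field
        label       : Point N → Label
        equivariant : ∀ {X} → Nonzero X → label (rotPoint X) ≡ rotLabel (label X)
        consistent  : ∀ {X Y} → Nonzero X → X ≼ Y → proj₂ (label X) ≡ proj₂ (label Y) → label X ≡ label Y

      Chain-consistent : ∀ {Xs} → AllPairs _≼_ Xs → All Nonzero Xs → Consistent (map label Xs)
      Chain-consistent {X ∷ Xs} (p ∷ ps) (nz ∷ nzs) (here refl) (here refl) eq = refl
      Chain-consistent {X ∷ Xs} (p ∷ ps) (nz ∷ nzs) (here refl) (there b∈) eq with ∈-map⁻ label b∈
      ... | Y , Y∈ , refl = consistent nz (All.lookup p Y∈) eq
      Chain-consistent {X ∷ Xs} (p ∷ ps) (nz ∷ nzs) (there b∈) (here refl) eq with ∈-map⁻ label b∈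
      ... | Y , Y∈ , refl = sym (consistent nz (All.lookup p Y∈) (sym eq))
      Chain-consistent {X ∷ Xs} (p ∷ ps) (nz ∷ nzs) (there a∈) (there b∈) eq =
        Chain-consistent ps nzs a∈ b∈ eq

      label-rot : ∀ {Xs} → All Nonzero Xs → map label (map rotPoint Xs) ≡ map rotLabel (map label Xs)
      label-rot []         = refl
      label-rot (nz ∷ nzs) = cong₂ _∷_ (equivariant nz) (label-rot nzs)

    open Labelling

    restrict : ∀ {n} → Labelling (suc n) → Labelling n
    restrict L .label X                                  = label L (nothing ∷ X)
    restrict L .equivariant (x , i , eq)                 = equivariant L (Fin.suc x , i , eq)
    restrict L .consistent {X} {Y} (x , i , eq) X≼Y      =
      consistent L (Fin.suc x , i , eq) (nothing-≼ {X = X} {Y} X≼Y)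

    -- Moves down one degree at a time: `δ` passes to the chain as a boundary, which is κ of the
    -- lower chain, then κ passes back to `U (suc n)` and yields `δ (U n)`. In the end the
    -- augmentation is evaluated on a single vertex.
    H-δU : ∀ n (L : Labelling (suc n)) → H (suc n) (δ (U n) ∘ map (label L)) ≈ 1ℤ
    H-δU zero    L = ≈-reflexive refl
    H-δU (suc n) L = ≈-trans
      (≈-reflexive (H-cong (suc (suc n)) λ {Xs} _ → δ-map (label L) (U (suc n)) Xs))
      (≈-trans (H-δ (suc n) (U (suc n) ∘ map (label L)))
      (≈-trans (≈-reflexive (H-cong (suc n) λ {Xs} c → begin
        Act.κ (suc n) (suc n) (U (suc n) ∘ map (label L) ∘ map (nothing ∷_)) Xs
          ≡⟨ Act.κ-cong (suc n) {P = λ _ → ⊤} (λ _ → tt)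
               (λ {Ys} _ → cong (U (suc n)) (sym (List.map-∘ Ys))) (suc n) tt ⟩
        Act.κ (suc n) (suc n) (U (suc n) ∘ map (label L′)) Xs
          ≡⟨ κ-pullback (label L′) {P = Chain (suc n)} Chain-rot
               (λ c → label-rot L′ (proj₂ (proj₂ c))) (suc n) (U (suc n)) c ⟩
        κ (suc n) (U (suc n)) (map (label L′) Xs)
          ≡⟨ κ-U n (Chain-consistent L′ (proj₁ (proj₂ c)) (proj₂ (proj₂ c))) ⟩
        δ (U n) (map (label L′) Xs) ∎))
      (H-δU n L′)))
      where
      open ≡-Reasoning
      L′ = restrict L

    -- The ℤ_p-Tucker lemma: no equivariant map (ℤ_p)^{*N} → (ℤ_p)^{*M} for M < N.
    tucker : 1 ℕ.≤ q → ∀ {N} → Labelling N → N ℕ.≤ M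
    tucker 1≤q {zero}  L = ℕ.z≤n
    tucker 1≤q {suc n} L = ℕ.≮⇒≥ λ M<N →
      let
        vanish : ∀ {σ} → Consistent σ × M ℕ.< length σ → U (suc n) σ ≡ 0ℤ
        vanish (c , l) = long⇒0 {U (suc n)} (U-alternating (suc n)) l c
        rot-long : ∀ {σ} → Consistent σ × M ℕ.< length σ → Consistent (map rotLabel σ) × M ℕ.< length (map rotLabel σ)
        rot-long {σ} (c , l) = Consistent-rot c , subst (M ℕ.<_) (sym (List.length-map rotLabel σ)) l
        -- Here `δ (U n)` equals κ of `U (suc n)`, which vanishes on flags with more than `M`
        -- labels.
        H≡0 : H (suc n) (δ (U n) ∘ map (label L)) ≡ 0ℤ
        H≡0 = H-0 (suc n) λ {Xs} c →
          let con = Chain-consistent L (proj₁ (proj₂ c)) (proj₂ (proj₂ c))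
              len = subst (M ℕ.<_) (sym (trans (List.length-map (label L) Xs) (proj₁ c))) M<N
          in trans (sym (κ-U n con))
               (trans (κ-cong {P = λ σ → Consistent σ × M ℕ.< length σ} (λ {σ} → rot-long {σ})
                         {w′ = λ _ → 0ℤ} (λ {σ} → vanish {σ}) (suc n) (con , len))
                      (κ-0 (suc n) (map (label L) Xs)))
      in absurd (subst (_≈ 1ℤ) H≡0 (H-δU n L))
      where
      κ-0 : ∀ n σ → κ n (λ _ → 0ℤ) σ ≡ 0ℤ
      κ-0 n σ = trans (κ-minus n (λ _ → 0ℤ) (λ _ → 0ℤ) σ) (ℤ.+-inverseʳ (κ n (λ _ → 0ℤ) σ))
      absurd : ¬ (0ℤ ≈ 1ℤ)
      absurd (mod-p p∣-1) = ℕ.<⇒≱ (ℕ.s≤s 1≤q) (ℕ∣.∣⇒≤ (ℤ∣.∣⇒∣ᵤ p∣-1))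

-- Finite sums, set families, and the bound to be proved for each uniformity

module Families where

  open import Data.Bool using (Bool; true; false; if_then_else_)
  open import Data.Nat using (ℕ; zero; suc; _+_; _*_; _≤_; _<_; _⊓_; z≤n)
  import Data.Nat.Properties as ℕ
  open import Data.Fin as Fin using (Fin; zero; suc; combine; _↑ˡ_; _↑ʳ_; inject₁; fromℕ)
  import Data.Fin.Properties as Fin
  open import Data.Fin.Subset using (Subset; _∈_; _⊆_; ∣_∣)
  open import Data.Fin.Subset.Properties using (⊆-antisym; _∈?_)
  open import Data.Maybe as Maybe using (Maybe; just; nothing)
  import Data.Maybe.Properties as Maybe
  open import Data.Vec as Vec using (Vec; lookup; tabulate; []; _∷_; here; there)
  import Data.Vec.Properties as Vec
  open import Data.Product as Product using (∃; _×_; _,_; proj₁; proj₂)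
  open import Data.Sum using (inj₁; inj₂)
  open import Function using (_∘_; id)
  open import Relation.Nullary using (¬_; Dec; yes; does)
  open import Relation.Nullary.Decidable using (map′; _⊎-dec_; _→-dec_)
  open import Relation.Unary using (Decidable)
  open import Relation.Binary.PropositionalEquality

  ∑ : ∀ {n} → (Fin n → ℕ) → ℕ
  ∑ f = Vec.sum (tabulate f)

  ∑-cong : ∀ {n} {f g : Fin n → ℕ} → f ≗ g → ∑ f ≡ ∑ g
  ∑-cong eq = cong Vec.sum (Vec.tabulate-cong eq)

  ∑-mono : ∀ {n} {f g : Fin n → ℕ} → (∀ i → f i ≤ g i) → ∑ f ≤ ∑ g
  ∑-mono {zero}  le = z≤n
  ∑-mono {suc n} le = ℕ.+-mono-≤ (le zero) (∑-mono (le ∘ suc))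

  ∑-const : ∀ n c → ∑ {n} (λ _ → c) ≡ n * c
  ∑-const zero    c = refl
  ∑-const (suc n) c = cong (c +_) (∑-const n c)

  ∑-+ : ∀ {n} (f g : Fin n → ℕ) → ∑ (λ i → f i + g i) ≡ ∑ f + ∑ g
  ∑-+ {zero}  f g = refl
  ∑-+ {suc n} f g = trans (cong (f zero + g zero +_) (∑-+ (f ∘ suc) (g ∘ suc)))
    (interchange (f zero) (g zero) (∑ (f ∘ suc)) (∑ (g ∘ suc)))
    where open import Algebra.Properties.CommutativeSemigroup ℕ.+-commutativeSemigroup using (interchange)

  term≤∑ : ∀ {n} (f : Fin n → ℕ) i → f i ≤ ∑ f
  term≤∑ f zero    = ℕ.m≤m+n (f zero) _
  term≤∑ f (suc i) = ℕ.≤-trans (term≤∑ (f ∘ suc) i) (ℕ.m≤n+m _ (f zero))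

  ∑-< : ∀ {n c} (f : Fin n → ℕ) i → (∀ i → f i ≤ c) → f i < c → ∑ f < n * c
  ∑-< {suc n} {c} f zero    le lt = ℕ.+-mono-<-≤ lt (ℕ.≤-trans (∑-mono (le ∘ suc)) (ℕ.≤-reflexive (∑-const n c)))
  ∑-< {suc n} {c} f (suc i) le lt = ℕ.+-mono-≤-< (le zero) (∑-< (f ∘ suc) i (le ∘ suc) lt)

  ∑-≤-≡⇒≗ : ∀ {n} {f g : Fin n → ℕ} → (∀ i → f i ≤ g i) → ∑ f ≡ ∑ g → f ≗ g
  ∑-≤-≡⇒≗ {suc n} {f} {g} le eq i = pointwise i
    where
    head : f zero ≡ g zero
    head = ℕ.≤-antisym (le zero) (ℕ.+-cancelʳ-≤ (∑ (f ∘ suc)) _ _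
      (ℕ.≤-trans (ℕ.+-monoʳ-≤ (g zero) (∑-mono (le ∘ suc))) (ℕ.≤-reflexive (sym eq))))
    pointwise : f ≗ g
    pointwise zero    = head
    pointwise (suc i) = ∑-≤-≡⇒≗ (le ∘ suc)
      (ℕ.+-cancelˡ-≡ (f zero) _ _ (trans eq (cong (_+ ∑ (g ∘ suc)) (sym head)))) i

  ∑-++ : ∀ m {n} (f : Fin (m + n) → ℕ) → ∑ f ≡ ∑ (λ i → f (i ↑ˡ n)) + ∑ (λ i → f (m ↑ʳ i))
  ∑-++ zero    f = refl
  ∑-++ (suc m) f = trans (cong (f zero +_) (∑-++ m (f ∘ suc))) (sym (ℕ.+-assoc (f zero) _ _))

  ∑-combine : ∀ m {n} (f : Fin (m * n) → ℕ) → ∑ f ≡ ∑ (λ i → ∑ (λ j → f (combine {m} {n} i j)))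
  ∑-combine zero    f = refl
  ∑-combine (suc m) {n} f = trans (∑-++ n f) (cong (λ z → ∑ (λ j → f (j ↑ˡ (m * n))) + z) (∑-combine m {n} (λ i → f (n ↑ʳ i))))

  ∑-init-last : ∀ {n} (f : Fin (suc n) → ℕ) → ∑ f ≡ ∑ (f ∘ inject₁) + f (fromℕ n)
  ∑-init-last {zero}  f = ℕ.+-comm (f zero) 0
  ∑-init-last {suc n} f = trans (cong (f zero +_) (∑-init-last (f ∘ suc))) (sym (ℕ.+-assoc (f zero) _ _))

  IsMin : ∀ {n} → ℕ → (Fin n → ℕ) → Set
  IsMin w a = (∀ i → w ≤ a i) × ∃ λ i → a i ≡ w

  minimum : ∀ {n} (a : Fin (suc n) → ℕ) → ∃ λ w → IsMin w a
  minimum {zero}  a = a zero , (λ { zero → ℕ.≤-refl }) , zero , refl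
  minimum {suc n} a with minimum (a ∘ suc)
  ... | w , w≤ , i , eq with ℕ.≤-total (a zero) w
  ... | inj₁ a₀≤w = a zero , (λ { zero → ℕ.≤-refl ; (suc j) → ℕ.≤-trans a₀≤w (w≤ j) }) , zero , refl
  ... | inj₂ w≤a₀ = w , (λ { zero → w≤a₀ ; (suc j) → w≤ j }) , suc i , eq

  IsMin-unique : ∀ {n v w} {a : Fin n → ℕ} → IsMin v a → IsMin w a → v ≡ w
  IsMin-unique (v≤ , i , refl) (w≤ , j , refl) = ℕ.≤-antisym (v≤ j) (w≤ i)

  first : ∀ {n} → (Fin n → Bool) → Maybe (Fin n)
  first {zero}  f = nothing
  first {suc n} f = if f zero then just zero else Maybe.map suc (first (f ∘ suc))

  first-cong : ∀ {n} {f g : Fin n → Bool} → f ≗ g → first f ≡ first g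
  first-cong {zero}  eq = refl
  first-cong {suc n} eq rewrite eq zero | first-cong (eq ∘ suc) = refl

  first-just : ∀ {n} (f : Fin n → Bool) {i} → first f ≡ just i → f i ≡ true
  first-just {suc n} f eq with f zero in f₀
  first-just {suc n} f refl | true = f₀
  first-just {suc n} f eq | false with first (f ∘ suc) in eq′
  first-just {suc n} f refl | false | just j = first-just (f ∘ suc) eq′

  first-nothing : ∀ {n} (f : Fin n → Bool) → first f ≡ nothing → ∀ i → f i ≡ false
  first-nothing {suc n} f eq i with f zero in f₀
  first-nothing {suc n} f eq i | false with first (f ∘ suc) in eq′
  first-nothing {suc n} f eq zero    | false | nothing = f₀
  first-nothing {suc n} f eq (suc i) | false | nothing = first-nothing (f ∘ suc) eq′ i

  ∈⇒lookup : ∀ {n} {B : Subset n} {x} → x ∈ B → lookup B x ≡ true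
  ∈⇒lookup = Vec.[]=⇒lookup

  lookup⇒∈ : ∀ {n} {B : Subset n} {x} → lookup B x ≡ true → x ∈ B
  lookup⇒∈ {B = B} {x} = Vec.lookup⇒[]= x B

  comprehend : ∀ {n} {P : Fin n → Set} → Decidable P → Subset n
  comprehend P? = tabulate (does ∘ P?)

  module _ {n} {P : Fin n → Set} (P? : Decidable P) where

    ∈-comprehend⁺ : ∀ {x} → P x → x ∈ comprehend P?
    ∈-comprehend⁺ {x} px = lookup⇒∈ (trans (Vec.lookup∘tabulate (does ∘ P?) x) (dec-true (P? x) px))
      where open import Relation.Nullary.Decidable using (dec-true)

    ∈-comprehend⁻ : ∀ {x} → x ∈ comprehend P? → P x
    ∈-comprehend⁻ {x} x∈ with P? x | trans (sym (Vec.lookup∘tabulate (does ∘ P?) x)) (∈⇒lookup x∈)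
    ... | yes px | _ = px

  element : ∀ {n} (B : Subset n) → Fin ∣ B ∣ → Fin n
  element (true  ∷ B) zero    = zero
  element (true  ∷ B) (suc i) = suc (element B i)
  element (false ∷ B) i       = suc (element B i)

  element-∈ : ∀ {n} (B : Subset n) i → element B i ∈ B
  element-∈ (true  ∷ B) zero    = here
  element-∈ (true  ∷ B) (suc i) = there (element-∈ B i)
  element-∈ (false ∷ B) i       = there (element-∈ B i)

  element-injective : ∀ {n} (B : Subset n) {i j} → element B i ≡ element B j → i ≡ j
  element-injective (true  ∷ B) {zero}  {zero}  eq = refl
  element-injective (true  ∷ B) {suc i} {suc j} eq = cong suc (element-injective B (Fin.suc-injective eq))
  element-injective (false ∷ B)                 eq = element-injective B (Fin.suc-injective eq)

  element-surjective : ∀ {n} {B : Subset n} {x} → x ∈ B → ∃ λ i → element B i ≡ x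
  element-surjective {B = true ∷ B}  here      = zero , refl
  element-surjective {B = true ∷ B}  (there p) = Product.map suc (cong suc) (element-surjective p)
  element-surjective {B = false ∷ B} (there p) = Product.map id (cong suc) (element-surjective p)

  -- A total injective relation replaces an injection, so that images may come from existential
  -- statements. The injection between the index sets is extracted from it.
  ∣∣-≤ : ∀ {m n} {A : Subset m} {B : Subset n} (R : Fin m → Fin n → Set) →
         (∀ {x} → x ∈ A → ∃ λ y → y ∈ B × R x y) →
         (∀ {x x′ y} → x ∈ A → x′ ∈ A → R x y → R x′ y → x ≡ x′) → ∣ A ∣ ≤ ∣ B ∣
  ∣∣-≤ {A = A} {B} R total injective = Fin.injective⇒≤ {f = f} f-injective
    where
    image : ∀ i → ∃ λ y → y ∈ B × R (element A i) y
    image i = total (element-∈ A i)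
    f : Fin ∣ A ∣ → Fin ∣ B ∣
    f i = proj₁ (element-surjective (proj₁ (proj₂ (image i))))
    f-image : ∀ i → element B (f i) ≡ proj₁ (image i)
    f-image i = proj₂ (element-surjective (proj₁ (proj₂ (image i))))
    f-injective : ∀ {i j} → f i ≡ f j → i ≡ j
    f-injective {i} {j} eq = element-injective A (injective (element-∈ A i) (element-∈ A j)
      (proj₂ (proj₂ (image i)))
      (subst (R (element A j)) (trans (sym (f-image j)) (trans (cong (element B) (sym eq)) (f-image i)))
             (proj₂ (proj₂ (image j)))))

  -- Transports subsets back when the elements of `B` have been made a ground set of their own, as
  -- in the inner application for composite uniformity.
  expand : ∀ {n} (B : Subset n) → Subset ∣ B ∣ → Subset n
  expand []          S       = []
  expand (true  ∷ B) (s ∷ S) = s ∷ expand B S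
  expand (false ∷ B) S       = false ∷ expand B S

  expand-⊆ : ∀ {n} (B : Subset n) S → expand B S ⊆ B
  expand-⊆ (true  ∷ B) (.true ∷ S) here = here
  expand-⊆ (true  ∷ B) (s ∷ S) (there p) = there (expand-⊆ B S p)
  expand-⊆ (false ∷ B) S       (there p) = there (expand-⊆ B S p)

  ∣expand∣ : ∀ {n} (B : Subset n) S → ∣ expand B S ∣ ≡ ∣ S ∣
  ∣expand∣ []          []          = refl
  ∣expand∣ (true  ∷ B) (true  ∷ S) = cong suc (∣expand∣ B S)
  ∣expand∣ (true  ∷ B) (false ∷ S) = ∣expand∣ B S
  ∣expand∣ (false ∷ B) S           = ∣expand∣ B S

  ∈-expand⁻ : ∀ {n} (B : Subset n) S {x} → x ∈ expand B S → ∃ λ i → i ∈ S × element B i ≡ x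
  ∈-expand⁻ (true  ∷ B) (.true ∷ S) here = zero , here , refl
  ∈-expand⁻ (true  ∷ B) (s ∷ S) (there p) with ∈-expand⁻ B S p
  ... | i , i∈ , eq = suc i , there i∈ , cong suc eq
  ∈-expand⁻ (false ∷ B) S       (there p) with ∈-expand⁻ B S p
  ... | i , i∈ , eq = i , i∈ , cong suc eq

  Family : ℕ → ℕ → Set
  Family r n = Fin r → Subset n

  Transversal : ∀ {n l} → (Fin n → Fin l) → Subset n → Set
  Transversal π B = ∀ {x y} → x ∈ B → y ∈ B → π x ≡ π y → x ≡ y

  Disjoint : ∀ {r n} → Family r n → Set
  Disjoint C = ∀ {i j x} → x ∈ C i → x ∈ C j → i ≡ j

  Packing : ∀ {r n l} → (Fin n → Fin l) → Family r n → Set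
  Packing π C = Disjoint C × (∀ i → Transversal π (C i))

  -- A disjoint family encoded as a partial colouring, so that families can be searched.
  Colouring : ℕ → ℕ → Set
  Colouring r n = Vec (Maybe (Fin r)) n

  class : ∀ {r n} → Colouring r n → Fin r → Subset n
  class X i = Vec.map (λ m → does (Maybe.≡-dec Fin._≟_ m (just i))) X

  module _ {r n} {X : Colouring r n} where

    ∈-class⁺ : ∀ {x i} → lookup X x ≡ just i → x ∈ class X i
    ∈-class⁺ {x} {i} eq = lookup⇒∈ (trans (Vec.lookup-map x _ X) (dec-true (Maybe.≡-dec Fin._≟_ _ _) eq))
      where open import Relation.Nullary.Decidable using (dec-true)

    ∈-class⁻ : ∀ {x i} → x ∈ class X i → lookup X x ≡ just i
    ∈-class⁻ {x} {i} x∈ with Maybe.≡-dec Fin._≟_ (lookup X x) (just i) | trans (sym (Vec.lookup-map x _ X)) (∈⇒lookup x∈)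
    ... | yes eq | _ = eq

    class-disjoint : Disjoint (class X)
    class-disjoint x∈i x∈j = Maybe.just-injective (trans (sym (∈-class⁻ x∈i)) (∈-class⁻ x∈j))

  paint : ∀ {r n} → Family r n → Colouring r n
  paint C = tabulate λ x → first λ i → lookup (C i) x

  class-paint : ∀ {r n} {C : Family r n} → Disjoint C → ∀ i → class (paint C) i ≡ C i
  class-paint {C = C} disjoint i = ⊆-antisym to from
    where
    look : ∀ x → lookup (paint C) x ≡ first (λ i → lookup (C i) x)
    look = Vec.lookup∘tabulate _
    to : class (paint C) i ⊆ C i
    to {x} x∈ = lookup⇒∈ (first-just (λ i → lookup (C i) x) (trans (sym (look x)) (∈-class⁻ x∈)))
    from : C i ⊆ class (paint C) i
    from {x} x∈ with first (λ i → lookup (C i) x) in eq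
    ... | just j  = ∈-class⁺ (trans (look x) (trans eq (cong just (disjoint (lookup⇒∈ (first-just _ eq)) x∈))))
    ... | nothing with () ← trans (sym (∈⇒lookup x∈)) (first-nothing (λ i → lookup (C i) x) eq i)

  anyMaybe? : ∀ {r} {P : Maybe (Fin r) → Set} → Decidable P → Dec (∃ P)
  anyMaybe? {P = P} P? = map′
    (λ { (inj₁ p) → nothing , p ; (inj₂ (i , p)) → just i , p })
    (λ { (nothing , p) → inj₁ p ; (just i , p) → inj₂ (i , p) })
    (P? nothing ⊎-dec Fin.any? (P? ∘ just))

  anyColouring? : ∀ {r n} {P : Colouring r n → Set} → Decidable P → Dec (∃ P)
  anyColouring? {n = zero}  P? = map′ (λ p → [] , p) (λ { ([] , p) → p }) (P? [])
  anyColouring? {n = suc n} P? = map′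
    (λ { (m , X , p) → m ∷ X , p })
    (λ { (m ∷ X , p) → m , X , p })
    (anyMaybe? λ m → anyColouring? λ X → P? (m ∷ X))

  transversal? : ∀ {n l} (π : Fin n → Fin l) B → Dec (Transversal π B)
  transversal? π B = map′ (λ f {x} {y} → f x y) (λ f x y → f {x} {y})
    (Fin.all? λ x → Fin.all? λ y → (x ∈? B) →-dec ((y ∈? B) →-dec ((π x Fin.≟ π y) →-dec (x Fin.≟ y))))

  -- Sizes are truncated only in `bound`. The sets themselves are trimmed to an equitable family at
  -- the very end.
  record Solution {n l k} (d : ℕ) (π : Fin n → Fin l) (G : Fin k → Subset n → Set) : Set where
    field
      family  : Family (suc d) n
      packing : Packing π family
      free    : ∀ a i → ¬ G a (family i)
      level   : ℕ
      isMin   : IsMin level (λ i → ∣ family i ∣)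
      bound   : n ≤ ∑ (λ i → ∣ family i ∣ ⊓ suc level) + d * k

  -- The chromatic bound for uniformity r = d + 1.  Elements x of the ground set lie in the part π x and
  -- have rank ρ x among the at most r elements of that part; G a is meant to hold of the sets which
  -- contain a vertex of colour a.
  Bound : ℕ → Set₁
  Bound d = ∀ {n l k} (π : Fin n → Fin l) (ρ : Fin n → Fin (suc d)) →
    (∀ {x y} → π x ≡ π y → ρ x ≡ ρ y → x ≡ y) →
    (G : Fin k → Subset n → Set) → (∀ a B → Dec (G a B)) →
    (∀ a (C : Family (suc d) n) → Packing π C → ¬ (∀ i → G a (C i))) →
    Solution d π G

-- The bound for a product of two uniformities

module CompositeUniformity where

  open Families
  open import Data.Nat using (ℕ; suc; _+_; _*_; _≤_; _<_; _⊓_; s≤s)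
  import Data.Nat.Properties as ℕ
  open import Data.Nat.Tactic.RingSolver using (solve-∀)
  open import Data.Fin as Fin using (Fin; suc; combine; remQuot)
  import Data.Fin.Properties as Fin
  open import Data.Fin.Subset using (Subset; _∈_; _⊆_; ∣_∣)
  open import Data.Fin.Subset.Properties using (_⊆?_)
  open import Data.Product using (∃; _×_; _,_; proj₁; proj₂; uncurry)
  open import Data.Sum using (inj₁; inj₂)
  open import Function using (_∘_)
  open import Relation.Nullary using (¬_; Dec)
  open import Relation.Nullary.Decidable using (_×-dec_)
  open import Relation.Binary.PropositionalEquality

  -- Lowers the truncation level from `w` to `v`. If the two agree, there is nothing to do.
  -- Otherwise all `b i` exceed `v`, so the truncated sum has its full value `suc d * suc v`. The
  -- sum for `a` is smaller by at least one because `v` is attained, and this one pays for the step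
  -- from `q` to `suc q`.
  truncation-bound : ∀ {n d q k v w} {a b : Fin (suc d) → ℕ} →
    IsMin v a → (∀ i → w ≤ b i) → ∀ {x} → x ≤ ∑ (λ i → b i ⊓ suc w) + k → n ≤ x → n ≤ suc q →
    q ≤ ∑ (λ i → a i ⊓ suc v) + k → v ≤ w → n ≤ ∑ (λ i → b i ⊓ suc v) + k
  truncation-bound {n} {d} {q} {k} {v} {w} {a} {b} (v≤a , i₀ , a₀≡v) w≤b {x} x≤ n≤x n≤q⁺ q≤ v≤w
    with ℕ.m≤n⇒m<n∨m≡n v≤w
  ... | inj₂ refl = ℕ.≤-trans n≤x x≤
  ... | inj₁ v<w = begin
    n                                   ≤⟨ n≤q⁺ ⟩
    suc q                               ≤⟨ s≤s q≤ ⟩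
    suc (∑ (λ i → a i ⊓ suc v) + k)     ≤⟨ ℕ.+-monoˡ-≤ k (∑-< (λ i → a i ⊓ suc v) i₀ (λ i → ℕ.m⊓n≤n (a i) (suc v))
                                             (subst (λ z → z ⊓ suc v < suc v) (sym a₀≡v) (s≤s (ℕ.m⊓n≤m v (suc v))))) ⟩
    suc d * suc v + k                   ≡⟨ cong (_+ k) (sym (∑-const (suc d) (suc v))) ⟩
    ∑ {suc d} (λ _ → suc v) + k         ≡⟨ cong (_+ k) (∑-cong (λ i → sym (ℕ.m≥n⇒m⊓n≡n (ℕ.≤-trans v<w (w≤b i))))) ⟩
    ∑ (λ i → b i ⊓ suc v) + k           ∎
    where
    open ℕ.≤-Reasoning

  module _ {r₁ r₂ : ℕ} where

    flatten : ∀ {n} → (Fin r₂ → Family r₁ n) → Family (r₂ * r₁) n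
    flatten A i = A (proj₁ (remQuot {r₂} r₁ i)) (proj₂ (remQuot {r₂} r₁ i))

    flatten-disjoint : ∀ {n} (B : Family r₂ n) (A : Fin r₂ → Family r₁ n) → Disjoint B →
                       (∀ β → Disjoint (A β)) → (∀ β α → A β α ⊆ B β) → Disjoint (flatten A)
    flatten-disjoint B A B-disjoint A-disjoint A⊆B {i} {j} {x} x∈i x∈j =
      trans (sym (Fin.combine-remQuot {r₂} r₁ i))
        (trans (cong (uncurry combine) (lem (remQuot {r₂} r₁ i) (remQuot {r₂} r₁ j) x∈i x∈j))
               (Fin.combine-remQuot {r₂} r₁ j))
      where
      lem : ∀ i j → x ∈ A (proj₁ i) (proj₂ i) → x ∈ A (proj₁ j) (proj₂ j) → i ≡ j
      lem (β , α) (β′ , α′) x∈i x∈j with B-disjoint (A⊆B β α x∈i) (A⊆B β′ α′ x∈j)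
      ... | refl = cong (β ,_) (A-disjoint β x∈i x∈j)

    flatten-combine : ∀ {n} (A : Fin r₂ → Family r₁ n) β α → flatten A (combine β α) ≡ A β α
    flatten-combine A β α = cong (uncurry A) (Fin.remQuot-combine {r₂} {r₁} β α)

  module Expand {n l k d : ℕ} (π : Fin n → Fin l) (B : Subset n) where

    expand-transversal : ∀ {S} → Transversal (π ∘ element B) S → Transversal π (expand B S)
    expand-transversal {S} t x∈ y∈ eq with ∈-expand⁻ B S x∈ | ∈-expand⁻ B S y∈
    ... | i , i∈ , refl | j , j∈ , refl = cong (element B) (t i∈ j∈ eq)

    expand-disjoint : ∀ {C : Family (suc d) ∣ B ∣} → Disjoint C → Disjoint (expand B ∘ C)
    expand-disjoint {C} disjoint {i} {j} x∈i x∈j with ∈-expand⁻ B (C i) x∈i | ∈-expand⁻ B (C j) x∈j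
    ... | x , x∈ , refl | y , y∈ , eq = disjoint x∈ (subst (_∈ C j) (element-injective B eq) y∈)

    module _ (G : Fin k → Subset n → Set) (S : Solution d (π ∘ element B) (λ a S → G a (expand B S))) where

      private module S = Solution S

      family : Family (suc d) n
      family i = expand B (S.family i)

      disjoint : Disjoint family
      disjoint = expand-disjoint (proj₁ S.packing)

      transversal : ∀ i → Transversal π (family i)
      transversal i = expand-transversal (proj₂ S.packing i)

      isMin : IsMin S.level (λ i → ∣ family i ∣)
      isMin with S.isMin
      ... | v≤ , α , eq = (λ α → subst (S.level ≤_) (sym (∣expand∣ B _)) (v≤ α)) , α , trans (∣expand∣ B _) eq

      bound : ∣ B ∣ ≤ ∑ (λ i → ∣ family i ∣ ⊓ suc S.level) + d * k
      bound = subst (λ z → ∣ B ∣ ≤ z + d * k) (∑-cong (λ i → cong (_⊓ suc S.level) (sym (∣expand∣ B (S.family i))))) S.bound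

  module Composite {d₁ d₂ n l k} (π : Fin n → Fin l) (ρ : Fin n → Fin (suc d₂ * suc d₁))
           (π-ρ-injective : ∀ {x y} → π x ≡ π y → ρ x ≡ ρ y → x ≡ y)
           (G : Fin k → Subset n → Set) (G? : ∀ a B → Dec (G a B)) where

    r₁ = suc d₁
    r₂ = suc d₂

    ρ₂ : Fin n → Fin r₂
    ρ₂ x = proj₁ (remQuot {r₂} r₁ (ρ x))

    ρ₁ : Fin n → Fin r₁
    ρ₁ x = proj₂ (remQuot {r₂} r₁ (ρ x))

    ρ-injective : ∀ {x y} → ρ₂ x ≡ ρ₂ y → ρ₁ x ≡ ρ₁ y → ρ x ≡ ρ y
    ρ-injective {x} {y} eq₂ eq₁ = trans (sym (Fin.combine-remQuot {r₂} r₁ (ρ x)))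
      (trans (cong₂ combine eq₂ eq₁) (Fin.combine-remQuot {r₂} r₁ (ρ y)))

    -- Every part is cut into r₁ parts with at most r₂ elements; transversals of the finer partition
    -- meet every original part in at most r₁ elements, ranked by ρ₁.
    π′ : Fin n → Fin (l * r₁)
    π′ x = combine (π x) (ρ₁ x)

    π′-ρ₂-injective : ∀ {x y} → π′ x ≡ π′ y → ρ₂ x ≡ ρ₂ y → x ≡ y
    π′-ρ₂-injective {x} {y} eq eq₂ with Fin.combine-injective (π x) (ρ₁ x) (π y) (ρ₁ y) eq
    ... | eq-π , eq₁ = π-ρ-injective eq-π (ρ-injective eq₂ eq₁)

    -- Formulated with colourings, because these can be searched exhaustively.
    G′ : Fin k → Subset n → Set
    G′ a B = ∃ λ (X : Colouring r₁ n) →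
      (∀ i → Transversal π (class X i)) × (∀ i → class X i ⊆ B) × (∀ i → G a (class X i))

    G′? : ∀ a B → Dec (G′ a B)
    G′? a B = anyColouring? λ X →
      Fin.all? (λ i → transversal? π (class X i)) ×-dec
      (Fin.all? (λ i → class X i ⊆? B) ×-dec Fin.all? (λ i → G? a (class X i)))

    -- Each of the r₂ disjoint sets contributes r₁ disjoint transversals, and together these
    -- contradict the original hypothesis.
    monochromatic′ : (∀ a (C : Family (r₂ * r₁) n) → Packing π C → ¬ (∀ i → G a (C i))) →
                     ∀ a (B : Family r₂ n) → Packing π′ B → ¬ (∀ β → G′ a (B β))
    monochromatic′ monochromatic a B (disjoint , _) g = monochromatic a (flatten A)
      (flatten-disjoint B A disjoint (λ β → class-disjoint {X = proj₁ (g β)}) (λ β → proj₁ (proj₂ (proj₂ (g β)))) ,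
       λ i → proj₁ (proj₂ (g (proj₁ (remQuot {r₂} r₁ i)))) _)
      (λ i → proj₂ (proj₂ (proj₂ (g (proj₁ (remQuot {r₂} r₁ i))))) _)
      where
      A : Fin r₂ → Family r₁ n
      A β = class (proj₁ (g β))

    module _ (outer : Solution d₂ π′ G′) where

      private module O = Solution outer
      open O using () renaming (family to B; level to q)

      element-π-ρ₁-injective : ∀ β {x y} → π (element (B β) x) ≡ π (element (B β) y) →
                               ρ₁ (element (B β) x) ≡ ρ₁ (element (B β) y) → x ≡ y
      element-π-ρ₁-injective β {x} {y} eq-π eq₁ = element-injective (B β)
        (proj₂ O.packing β (element-∈ (B β) x) (element-∈ (B β) y) (cong₂ combine eq-π eq₁))

      -- Such a family would witness that `B β` belongs to `G′ a`, which the outer solution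
      -- excludes.
      monochromatic-inner : ∀ β a (C : Family r₁ ∣ B β ∣) → Packing (π ∘ element (B β)) C →
                            ¬ (∀ i → G a (expand (B β) (C i)))
      monochromatic-inner β a C (disjoint , transversal) g = O.free a β
        (paint C′ ,
         (λ i → subst (Transversal π) (sym (paint-C′ i)) (expand-transversal {C i} (transversal i))) ,
         (λ i → subst (_⊆ B β) (sym (paint-C′ i)) (expand-⊆ (B β) (C i))) ,
         (λ i → subst (G a) (sym (paint-C′ i)) (g i)))
        where
        open Expand {k = k} {d = d₁} π (B β) using (expand-disjoint; expand-transversal)
        C′ : Family r₁ n
        C′ i = expand (B β) (C i)
        paint-C′ : ∀ i → class (paint C′) i ≡ C′ i
        paint-C′ = class-paint {C = C′} (expand-disjoint {C} disjoint)

      module _ (inner : ∀ β → Solution d₁ (π ∘ element (B β)) (λ a S → G a (expand (B β) S))) where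

        private module E β = Expand {k = k} {d = d₁} π (B β)

        A : Fin r₂ → Family r₁ n
        A β = E.family β G (inner β)

        v : Fin r₂ → ℕ
        v β = Solution.level (inner β)

        module _ {w} (w-isMin : IsMin w v) where

          private
            w≤v = proj₁ w-isMin
            β₀ = proj₁ (proj₂ w-isMin)
            v≡w = proj₂ (proj₂ w-isMin)

          flatten-isMin : IsMin w (λ i → ∣ flatten {r₁} {r₂} A i ∣)
          flatten-isMin with E.isMin β₀ G (inner β₀)
          ... | _ , α₀ , eq =
            (λ i → ℕ.≤-trans (w≤v _) (proj₁ (E.isMin (proj₁ (remQuot {r₂} r₁ i)) G (inner _)) _)) ,
            combine β₀ α₀ , trans (cong ∣_∣ (flatten-combine A β₀ α₀)) (trans eq v≡w)

          -- The inner solutions have different levels, but the glued family needs the least one.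
          -- The loss is harmless since `B β` counts only up to `suc q`, while the block `β₀` of
          -- least level covers at least `q` elements.
          block : ∀ β → ∣ B β ∣ ⊓ suc q ≤ ∑ (λ α → ∣ A β α ∣ ⊓ suc w) + d₁ * k
          block β = truncation-bound {q = q} {a = λ α → ∣ A β₀ α ∣}
            (subst (λ z → IsMin z (λ α → ∣ A β₀ α ∣)) v≡w (E.isMin β₀ G (inner β₀)))
            (proj₁ (E.isMin β G (inner β))) (E.bound β G (inner β))
            (ℕ.m⊓n≤m ∣ B β ∣ (suc q)) (ℕ.m⊓n≤n ∣ B β ∣ (suc q))
            (ℕ.≤-trans (proj₁ O.isMin β₀)
              (subst (λ z → ∣ B β₀ ∣ ≤ ∑ (λ α → ∣ A β₀ α ∣ ⊓ suc z) + d₁ * k) v≡w (E.bound β₀ G (inner β₀))))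
            (w≤v β)

          -- The losses combine because r₂ (r₁ - 1) + (r₂ - 1) = r₂ r₁ - 1.
          flatten-bound : n ≤ ∑ (λ i → ∣ flatten {r₁} {r₂} A i ∣ ⊓ suc w) + (d₁ + d₂ * suc d₁) * k
          flatten-bound = begin
            n
              ≤⟨ O.bound ⟩
            ∑ (λ β → ∣ B β ∣ ⊓ suc q) + d₂ * k
              ≤⟨ ℕ.+-monoˡ-≤ (d₂ * k) (∑-mono block) ⟩
            ∑ (λ β → ∑ (λ α → ∣ A β α ∣ ⊓ suc w) + d₁ * k) + d₂ * k
              ≡⟨ cong (_+ d₂ * k) (∑-+ (λ β → ∑ (λ α → ∣ A β α ∣ ⊓ suc w)) (λ _ → d₁ * k)) ⟩
            ∑ (λ β → ∑ (λ α → ∣ A β α ∣ ⊓ suc w)) + ∑ {r₂} (λ _ → d₁ * k) + d₂ * k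
              ≡⟨ cong₂ (λ x y → x + y + d₂ * k)
                   (trans (∑-cong (λ β → ∑-cong (λ α → cong (λ S → ∣ S ∣ ⊓ suc w) (sym (flatten-combine A β α)))))
                          (sym (∑-combine r₂ {r₁} (λ i → ∣ flatten {r₁} {r₂} A i ∣ ⊓ suc w))))
                   (∑-const r₂ (d₁ * k)) ⟩
            ∑ (λ i → ∣ flatten {r₁} {r₂} A i ∣ ⊓ suc w) + r₂ * (d₁ * k) + d₂ * k
              ≡⟨ arithmetic (∑ (λ i → ∣ flatten {r₁} {r₂} A i ∣ ⊓ suc w)) d₁ d₂ k ⟩
            ∑ (λ i → ∣ flatten {r₁} {r₂} A i ∣ ⊓ suc w) + (d₁ + d₂ * suc d₁) * k ∎
            where
            open ℕ.≤-Reasoning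
            arithmetic : ∀ s d₁ d₂ k → s + suc d₂ * (d₁ * k) + d₂ * k ≡ s + (d₁ + d₂ * suc d₁) * k
            arithmetic = solve-∀

        glue : Solution (d₁ + d₂ * suc d₁) π G
        glue = record
          { family  = flatten {r₁} {r₂} A
          ; packing = flatten-disjoint {r₁} {r₂} B A (proj₁ O.packing) (λ β → E.disjoint β G (inner β)) (λ β α → expand-⊆ (B β) _) ,
                      λ i → E.transversal (proj₁ (remQuot {r₂} r₁ i)) G (inner _) _
          ; free    = λ a i → Solution.free (inner (proj₁ (remQuot {r₂} r₁ i))) a _
          ; level   = proj₁ (minimum v)
          ; isMin   = flatten-isMin (proj₂ (minimum v))
          ; bound   = flatten-bound (proj₂ (minimum v))
          }

  -- The index is written so that its successor reduces to `suc d₂ * suc d₁`.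
  Bound-* : ∀ {d₁ d₂} → Bound d₁ → Bound d₂ → Bound (d₁ + d₂ * suc d₁)
  Bound-* {d₁} {d₂} bound₁ bound₂ π ρ π-ρ-injective G G? monochromatic = glue outer λ β →
    bound₁ (π ∘ element (B β)) (ρ₁ ∘ element (B β)) (element-π-ρ₁-injective outer β)
      (λ a S → G a (expand (B β) S)) (λ a S → G? a (expand (B β) S)) (monochromatic-inner outer β)
    where
    open Composite {d₁} {d₂} π ρ π-ρ-injective G G?
    outer = bound₂ π′ ρ₂ π′-ρ₂-injective G′ G′? (monochromatic′ monochromatic)
    B = Solution.family outer

-- Averaging subsets of the cyclic group of prime order

module EquivariantChoice where

  open JoinChains
  open Families
  open import Data.Bool using (Bool; true; false)
  open import Data.Nat using (ℕ; zero; suc; _+_; _*_; _≤_; _<_; z≤n; s≤s; >-nonZero)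
  import Data.Nat.Properties as ℕ
  open import Data.Nat.DivMod using (_%_; _mod_; m<n⇒m%n≡m; n%n≡0; %-distribˡ-+; %-distribˡ-*; [m+kn]%n≡m%n; m%n%n≡m%n)
  open import Data.Nat.Primality using (Prime)
  open import Data.Nat.Coprimality as Coprime using (Coprime; coprime?; coprime-Bézout; prime⇒coprime)
  open import Data.Nat.GCD using (module Bézout)
  open import Data.Nat.Tactic.RingSolver using (solve-∀)
  open import Data.Fin as Fin using (Fin; zero; suc; toℕ; inject₁; fromℕ)
  import Data.Fin.Properties as Fin
  open import Data.Product using (∃; _×_; _,_; proj₁; proj₂)
  open import Function using (_∘_)
  open import Relation.Nullary using (yes; no; contradiction)
  open import Relation.Binary.PropositionalEquality

  Mixed : ∀ {n} → (Fin n → Bool) → Set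
  Mixed S = (∃ λ i → S i ≡ true) × (∃ λ i → S i ≡ false)

  module Rotate (q : ℕ) where
    open Sign q

    rot-inject₁ : ∀ i → rot (inject₁ i) ≡ suc i
    rot-inject₁ i = Fin.toℕ-injective (begin
      toℕ (rot (inject₁ i))        ≡⟨ toℕ-rot (inject₁ i) ⟩
      suc (toℕ (inject₁ i)) % p    ≡⟨ cong (λ z → suc z % p) (Fin.toℕ-inject₁ i) ⟩
      suc (toℕ i) % p              ≡⟨ m<n⇒m%n≡m (s≤s (Fin.toℕ<n i)) ⟩
      suc (toℕ i)                  ∎)
      where open ≡-Reasoning

    rot-fromℕ : rot (fromℕ q) ≡ zero
    rot-fromℕ = Fin.toℕ-injective (begin
      toℕ (rot (fromℕ q))       ≡⟨ toℕ-rot (fromℕ q) ⟩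
      suc (toℕ (fromℕ q)) % p   ≡⟨ cong (λ z → suc z % p) (Fin.toℕ-fromℕ q) ⟩
      p % p                     ≡⟨ n%n≡0 p ⟩
      0                         ∎)
      where open ≡-Reasoning

    ∑-rot : ∀ (f : Fin p → ℕ) → ∑ (f ∘ rot) ≡ ∑ f
    ∑-rot f = begin
      ∑ (f ∘ rot)                                ≡⟨ ∑-init-last (f ∘ rot) ⟩
      ∑ (f ∘ rot ∘ inject₁) + f (rot (fromℕ q))  ≡⟨ cong₂ _+_ (∑-cong (λ i → cong f (rot-inject₁ i))) (cong f rot-fromℕ) ⟩
      ∑ (f ∘ suc) + f zero                       ≡⟨ ℕ.+-comm (∑ (f ∘ suc)) (f zero) ⟩
      ∑ f                                        ∎
      where open ≡-Reasoning

    %-cong-+ : ∀ {a b c d} → a % p ≡ b % p → c % p ≡ d % p → (a + c) % p ≡ (b + d) % p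
    %-cong-+ {a} {b} {c} {d} eq eq′ =
      trans (%-distribˡ-+ a c p) (trans (cong₂ (λ x y → (x + y) % p) eq eq′) (sym (%-distribˡ-+ b d p)))

    %-congˡ-* : ∀ a c d → c % p ≡ d % p → (a * c) % p ≡ (a * d) % p
    %-congˡ-* a c d eq =
      trans (%-distribˡ-* a c p) (trans (cong (λ y → (a % p * y) % p) eq) (sym (%-distribˡ-* a d p)))

    ∑-%-cong : ∀ {n} {f g : Fin n → ℕ} → (∀ i → f i % p ≡ g i % p) → ∑ f % p ≡ ∑ g % p
    ∑-%-cong {zero}          eq = refl
    ∑-%-cong {suc n} {f} {g} eq = %-cong-+ {f zero} {g zero} (eq zero) (∑-%-cong (eq ∘ suc))

    inverse∃ : ∀ {s} → Coprime s p → ∃ λ t → (t * s) % p ≡ 1 % p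
    inverse∃ {s} c with coprime-Bézout c
    ... | Bézout.+- x y eq = x , trans (cong (_% p) (sym eq)) ([m+kn]%n≡m%n 1 y p)
    -- Now -x is the inverse, and q = p - 1 represents -1.
    ... | Bézout.-+ x y eq = q * x , (begin
      (q * x * s) % p                ≡⟨ sym ([m+kn]%n≡m%n (q * x * s) y p) ⟩
      (q * x * s + y * p) % p        ≡⟨ cong (λ z → (q * x * s + z) % p) (sym eq) ⟩
      (q * x * s + (1 + x * s)) % p  ≡⟨ cong (_% p) (lem q x s) ⟩
      (1 + x * s * p) % p            ≡⟨ [m+kn]%n≡m%n 1 (x * s) p ⟩
      1 % p                          ∎)
      where
      open ≡-Reasoning
      lem : ∀ q x s → q * x * s + (1 + x * s) ≡ 1 + x * s * suc q
      lem = solve-∀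

    -- Goes through the decision `coprime?`, so that the result depends on `s` alone and not on a
    -- proof of coprimality.
    inverse : ℕ → ℕ
    inverse s with coprime? s p
    ... | yes c = proj₁ (inverse∃ c)
    ... | no  _ = 0

    inverse-* : ∀ {s} → Coprime s p → (inverse s * s) % p ≡ 1 % p
    inverse-* {s} c with coprime? s p
    ... | yes c′ = proj₂ (inverse∃ c′)
    ... | no  ¬c = contradiction (λ {d} → c {d}) ¬c

    bit : Bool → ℕ
    bit true  = 1
    bit false = 0

    size weight : (Fin p → Bool) → ℕ
    size   S = ∑ λ i → bit (S i)
    weight S = ∑ λ i → bit (S i) * toℕ i

    -- The mean of S modulo p, an equivariant choice of an element of ℤ_p for each proper nonempty S.
    choose : (Fin p → Bool) → Fin p
    choose S = (inverse (size S) * weight S) mod p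

    choose-cong : ∀ {S S′} → S ≗ S′ → choose S ≡ choose S′
    choose-cong eq = cong₂ (λ s w → (inverse s * w) mod p)
      (∑-cong (λ i → cong bit (eq i))) (∑-cong (λ i → cong (λ b → bit b * toℕ i) (eq i)))

    module _ {S S′ : Fin p → Bool} (eq : ∀ i → S′ (rot i) ≡ S i) where

      size-rot : size S′ ≡ size S
      size-rot = trans (sym (∑-rot (bit ∘ S′))) (∑-cong (λ i → cong bit (eq i)))

      -- Each element of the set grows by one modulo p, so the weight grows by the number of
      -- elements.
      weight-rot : weight S′ % p ≡ (weight S + size S) % p
      weight-rot = begin
        weight S′ % p                                         ≡⟨ cong (_% p) (sym (∑-rot (λ i → bit (S′ i) * toℕ i))) ⟩
        ∑ (λ i → bit (S′ (rot i)) * toℕ (rot i)) % p          ≡⟨ cong (_% p) (∑-cong (λ i → cong₂ _*_ (cong bit (eq i)) (toℕ-rot i))) ⟩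
        ∑ (λ i → bit (S i) * (suc (toℕ i) % p)) % p           ≡⟨ ∑-%-cong {f = λ i → bit (S i) * (suc (toℕ i) % p)}
                                                                           {g = λ i → bit (S i) * suc (toℕ i)} (λ i →
                                                                   %-congˡ-* (bit (S i)) (suc (toℕ i) % p) (suc (toℕ i)) (m%n%n≡m%n (suc (toℕ i)) p)) ⟩
        ∑ (λ i → bit (S i) * suc (toℕ i)) % p                 ≡⟨ cong (_% p) (∑-cong (λ i → lem (bit (S i)) (toℕ i))) ⟩
        ∑ (λ i → bit (S i) * toℕ i + bit (S i)) % p           ≡⟨ cong (_% p) (∑-+ (λ i → bit (S i) * toℕ i) (bit ∘ S)) ⟩
        (weight S + size S) % p                               ∎
        where
        open ≡-Reasoning
        lem : ∀ b i → b * suc i ≡ b * i + b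
        lem = solve-∀

      -- The weight grows by the size, hence the quotient by one. The size lies strictly between 0
      -- and p, so primality makes it invertible.
      choose-rot : Prime p → Mixed S → choose S′ ≡ rot (choose S)
      choose-rot p-prime ((i , Si) , (j , Sj)) = Fin.toℕ-injective (begin
        toℕ (choose S′)                             ≡⟨ toℕ-mod (inverse (size S′) * weight S′) ⟩
        (inverse (size S′) * weight S′) % p         ≡⟨ cong (λ s → (inverse s * weight S′) % p) size-rot ⟩
        (t * weight S′) % p                         ≡⟨ %-congˡ-* t (weight S′) (weight S + size S) weight-rot ⟩
        (t * (weight S + size S)) % p               ≡⟨ cong (_% p) (lem t (weight S) (size S)) ⟩
        (t * size S + t * weight S) % p             ≡⟨ %-cong-+ {t * size S} {1} (inverse-* coprime) (sym (m%n%n≡m%n (t * weight S) p)) ⟩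
        suc ((t * weight S) % p) % p                ≡⟨ cong (λ z → suc z % p) (sym (toℕ-mod (t * weight S))) ⟩
        suc (toℕ (choose S)) % p                    ≡⟨ sym (toℕ-rot (choose S)) ⟩
        toℕ (rot (choose S))                        ∎)
        where
        open ≡-Reasoning
        t = inverse (size S)
        lem : ∀ t w s → t * (w + s) ≡ t * s + t * w
        lem = solve-∀
        bit≤1 : ∀ b → bit b ≤ 1
        bit≤1 true  = ℕ.≤-refl
        bit≤1 false = z≤n
        0<size : 0 < size S
        0<size = ℕ.≤-trans (ℕ.≤-reflexive (cong bit (sym Si))) (term≤∑ (bit ∘ S) i)
        size<p : size S < p
        size<p = subst (size S <_) (ℕ.*-identityʳ p)
          (∑-< (bit ∘ S) j (λ i → bit≤1 (S i)) (subst (λ b → bit b < 1) (sym Sj) (s≤s z≤n)))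
        coprime : Coprime (size S) p
        coprime = Coprime.sym (prime⇒coprime p-prime {{>-nonZero 0<size}} size<p)

-- The bound for prime uniformity, by a labelling of partial colourings

module PrimeUniformity where

  open JoinChains
  open TuckerLemma
  open Families
  open EquivariantChoice
  open import Data.Bool as Bool using (Bool; true; false; if_then_else_)
  open import Data.Nat as ℕ using (ℕ; zero; suc; _+_; _*_; _∸_; _≤_; _<_; _⊓_; z≤n; s≤s; NonZero; >-nonZero)
  import Data.Nat.Properties as ℕ
  open import Data.Nat.DivMod using (_%_; _mod_; m%n<n; m<n⇒m%n≡m; [m+kn]%n≡m%n)
  open import Data.Nat.Primality using (Prime)
  open import Data.Fin as Fin using (Fin; zero; suc; toℕ)
  import Data.Fin.Properties as Fin
  open import Data.Fin.Subset using (Subset; _∈_; _∉_; _⊆_; ∣_∣)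
  open import Data.Fin.Subset.Properties using (⊆-antisym; _∈?_; _⊆?_; anySubset?; p⊆q⇒∣p∣≤∣q∣; p⊂q⇒∣p∣<∣q∣; ∣⊤∣≡n; ∈⊤; ⊆⊤)
  open import Data.Maybe as Maybe using (Maybe; just; nothing; maybe′)
  import Data.Maybe.Properties as Maybe
  open import Data.Vec as Vec using (Vec; lookup; []; _∷_)
  import Data.Vec.Properties as Vec
  open import Data.Product as Product using (∃; _×_; _,_; proj₁; proj₂)
  open import Data.Sum using (inj₁; inj₂)
  open import Function using (_∘_; id)
  open import Relation.Nullary using (¬_; Dec; yes; no; does; contradiction)
  open import Relation.Nullary.Decidable using (map′; _×-dec_; dec-true; dec-false; does-≡; decidable-stable)
  open import Relation.Binary.PropositionalEquality

  does⇒ : ∀ {P : Set} (P? : Dec P) → does P? ≡ true → P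
  does⇒ (yes p) _ = p

  does-false⇒ : ∀ {P : Set} (P? : Dec P) → does P? ≡ false → ¬ P
  does-false⇒ (no ¬p) _ = ¬p

  does-cong : ∀ {P Q : Set} (P? : Dec P) (Q? : Dec Q) → (P → Q) → (Q → P) → does P? ≡ does Q?
  does-cong P? Q? to from = does-≡ P? (map′ from to Q?)

  if-yes : ∀ {P A : Set} (P? : Dec P) {a b : A} → P → (if does P? then a else b) ≡ a
  if-yes P? p = cong (if_then _ else _) (dec-true P? p)

  if-no : ∀ {P A : Set} (P? : Dec P) {a b : A} → ¬ P → (if does P? then a else b) ≡ b
  if-no P? ¬p = cong (if_then _ else _) (dec-false P? ¬p)

  ⊆-∣∣⇒⊇ : ∀ {n} {A B : Subset n} → A ⊆ B → ∣ B ∣ ≤ ∣ A ∣ → B ⊆ A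
  ⊆-∣∣⇒⊇ {A = A} A⊆B ∣B∣≤∣A∣ {x} x∈B = decidable-stable (x ∈? A)
    λ x∉A → ℕ.<⇒≱ (p⊂q⇒∣p∣<∣q∣ (A⊆B , x , x∈B , x∉A)) ∣B∣≤∣A∣

  ∈⇒0<∣∣ : ∀ {n} {B : Subset n} {x} → x ∈ B → 0 < ∣ B ∣
  ∈⇒0<∣∣ {B = B} {x} x∈ = ∣∣-≤ {A = true ∷ []} (λ _ y → y ≡ x) (λ _ → x , x∈ , refl) λ { {zero} {zero} _ _ _ _ → refl }

  ∉⇒∣∣<n : ∀ {n} {B : Subset n} {x} → x ∉ B → ∣ B ∣ < n
  ∉⇒∣∣<n {n} {B} {x} x∉ = subst (∣ B ∣ <_) (∣⊤∣≡n n) (p⊂q⇒∣p∣<∣q∣ (⊆⊤ , x , ∈⊤ , x∉))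

  lookup-injective : ∀ {A : Set} {n} {u v : Vec A n} → (∀ i → lookup u i ≡ lookup v i) → u ≡ v
  lookup-injective {u = u} {v} eq =
    trans (sym (Vec.tabulate∘lookup u)) (trans (Vec.tabulate-cong eq) (Vec.tabulate∘lookup v))

  mixed? : ∀ {n} (S : Fin n → Bool) → Dec (Mixed S)
  mixed? S = Fin.any? (λ i → S i Bool.≟ true) ×-dec Fin.any? (λ i → S i Bool.≟ false)

  Mixed-transfer : ∀ {n} {S S′ : Fin n → Bool} (σ : Fin n → Fin n) → (∀ i → S′ (σ i) ≡ S i) → Mixed S → Mixed S′
  Mixed-transfer σ eq ((i , Si) , (j , Sj)) = (σ i , trans (eq i) Si) , (σ j , trans (eq j) Sj)

  another : ∀ {q} → 1 ≤ q → (i : Fin (suc q)) → ∃ λ j → i ≢ j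
  another (s≤s _) zero    = suc zero , λ ()
  another (s≤s _) (suc i) = zero , λ ()

  module Parts {n l} (π : Fin n → Fin l) where

    occurs? : (B : Subset n) (j : Fin l) (x : Fin n) → Dec (x ∈ B × π x ≡ j)
    occurs? B j x = (x ∈? B) ×-dec (π x Fin.≟ j)

    meets? : (B : Subset n) (j : Fin l) → Dec (∃ λ x → x ∈ B × π x ≡ j)
    meets? B j = Fin.any? (occurs? B j)

    parts : Subset n → Subset l
    parts B = comprehend (meets? B)

    parts-⊆ : ∀ {A B} → A ⊆ B → parts A ⊆ parts B
    parts-⊆ {A} {B} A⊆B j∈ with ∈-comprehend⁻ (meets? A) j∈
    ... | x , x∈A , eq = ∈-comprehend⁺ (meets? B) (x , A⊆B x∈A , eq)

    rep : Subset n → Fin l → Maybe (Fin n)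
    rep B j = first (λ x → does (occurs? B j x))

    isRep? : ∀ B x → Dec (rep B (π x) ≡ just x)
    isRep? B x = Maybe.≡-dec Fin._≟_ (rep B (π x)) (just x)

    representatives : Subset n → Subset n
    representatives B = comprehend (isRep? B)

    representatives-⊆ : ∀ {B} → representatives B ⊆ B
    representatives-⊆ {B} {x} x∈ =
      proj₁ (does⇒ (occurs? B (π x) x) (first-just (λ y → does (occurs? B (π x) y)) (∈-comprehend⁻ (isRep? B) x∈)))

    representatives-transversal : ∀ {B} → Transversal π (representatives B)
    representatives-transversal {B} {x} {y} x∈ y∈ eq = Maybe.just-injective
      (trans (sym (∈-comprehend⁻ (isRep? B) x∈)) (trans (cong (rep B) eq) (∈-comprehend⁻ (isRep? B) y∈)))

    -- Turns the number of parts met by a class into the size of an actual transversal inside it.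
    ∣representatives∣ : ∀ B → ∣ representatives B ∣ ≡ ∣ parts B ∣
    ∣representatives∣ B = ℕ.≤-antisym
      (∣∣-≤ (λ x j → π x ≡ j)
        (λ {x} x∈ → π x , ∈-comprehend⁺ (meets? B) (x , representatives-⊆ {B} x∈ , refl) , refl)
        (λ {x} {y} x∈ y∈ eq eq′ → representatives-transversal {B} {x} {y} x∈ y∈ (trans eq (sym eq′))))
      (∣∣-≤ (λ j x → π x ≡ j) represent (λ _ _ eq eq′ → trans (sym eq) eq′))
      where
      represent : ∀ {j} → j ∈ parts B → ∃ λ x → x ∈ representatives B × π x ≡ j
      represent {j} j∈ with rep B j in eq
      ... | nothing with ∈-comprehend⁻ (meets? B) j∈
      ...   | y , occ = contradiction occ (does-false⇒ (occurs? B j y) (first-nothing _ eq y))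
      represent {j} j∈ | just x with does⇒ (occurs? B j x) (first-just (λ y → does (occurs? B j y)) eq)
      ... | x∈B , refl = x , ∈-comprehend⁺ (isRep? B) eq , refl

  firstColour : ∀ {r n} → Colouring r n → Maybe (Fin r)
  firstColour []            = nothing
  firstColour (just i ∷ X)  = just i
  firstColour (nothing ∷ X) = firstColour X

  firstColour-just : ∀ {r n} {X : Colouring r n} {x i} → lookup X x ≡ just i → ∃ λ i → firstColour X ≡ just i
  firstColour-just {X = just i ∷ X}                eq = i , refl
  firstColour-just {X = nothing ∷ X} {x = suc x}   eq = firstColour-just {X = X} {x} eq

  module SmallTucker (q M : ℕ) where
    open Sign q
    open Label q M using (Labelling; tucker)

    -- Values are bounded at nonzero points only. Reduction modulo `M` gives the blank point a label
    -- too and changes nothing elsewhere.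
    tucker-ℕ : 1 ≤ q → ∀ {N} (sgn : Point N → Fin p) (val : Point N → ℕ) →
      (∀ {X} → Nonzero X → val X < M) →
      (∀ {X} → Nonzero X → val (rotPoint X) ≡ val X) →
      (∀ {X} → Nonzero X → sgn (rotPoint X) ≡ rot (sgn X)) →
      (∀ {X Y} → Nonzero X → Nonzero Y → X ≼ Y → val X ≡ val Y → sgn X ≡ sgn Y) → N ≤ M
    tucker-ℕ 1≤q {zero} sgn val bound val-rot sgn-rot consistent = z≤n
    tucker-ℕ 1≤q {suc N} sgn val bound val-rot sgn-rot consistent = tucker 1≤q record
      { label       = λ X → sgn X , val X mod M
      ; equivariant = λ nz → cong₂ _,_ (sgn-rot nz) (cong (_mod M) (val-rot nz))
      ; consistent  = λ {X} {Y} nz X≼Y eq →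
          let nz′ = proj₁ nz , proj₁ (proj₂ nz) , X≼Y _ (proj₂ (proj₂ nz))
          in cong₂ _,_ (consistent nz nz′ X≼Y (val-≡ {X} {Y} nz nz′ eq)) eq
      }
      where
      instance
        -- The bound at a point with a single coloured element shows that `M` is positive. Such a
        -- point requires a nonempty ground set, hence the separate case of length zero.
        M≢0 : NonZero M
        M≢0 = >-nonZero (ℕ.≤-<-trans z≤n (bound {just zero ∷ Vec.replicate N nothing} (zero , zero , refl)))
      val-≡ : ∀ {X Y} → Nonzero X → Nonzero Y → val X mod M ≡ val Y mod M → val X ≡ val Y
      val-≡ {X} {Y} nz nz′ eq = begin
        val X              ≡⟨ sym (m<n⇒m%n≡m (bound nz)) ⟩
        val X % M          ≡⟨ sym (Fin.toℕ-fromℕ< (m%n<n (val X) M)) ⟩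
        toℕ (val X mod M)  ≡⟨ cong toℕ eq ⟩
        toℕ (val Y mod M)  ≡⟨ Fin.toℕ-fromℕ< (m%n<n (val Y) M) ⟩
        val Y % M          ≡⟨ m<n⇒m%n≡m (bound nz′) ⟩
        val Y              ∎
        where open ≡-Reasoning

  module PrimeCase (q : ℕ) (1≤q : 1 ≤ q) (p-prime : Prime (suc q))
           {n l k} (π : Fin n → Fin l) (ρ : Fin n → Fin (suc q))
           (π-ρ-injective : ∀ {x y} → π x ≡ π y → ρ x ≡ ρ y → x ≡ y)
           (G : Fin k → Subset n → Set) (G? : ∀ a B → Dec (G a B))
           (monochromatic : ∀ a (C : Family (suc q) n) → Packing π C → ¬ (∀ i → G a (C i)))
           (unsolvable : ¬ Solution q π G) where

    open Sign q
    open Rotate q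
    open Parts π

    -- The closure under supersets makes the set `big X a` grow along `_≼_`.
    Big : Fin k → Subset n → Set
    Big a B = ∃ λ C → C ⊆ B × Transversal π C × G a C

    Big? : ∀ a B → Dec (Big a B)
    Big? a B = anySubset? λ C → (C ⊆? B) ×-dec (transversal? π C ×-dec G? a C)

    Big-⊆ : ∀ {a A B} → A ⊆ B → Big a A → Big a B
    Big-⊆ A⊆B (C , C⊆A , rest) = C , A⊆B ∘ C⊆A , rest

    rot-class : ∀ (X : Point n) i → class (rotPoint X) (rot i) ≡ class X i
    rot-class X i = ⊆-antisym
      (λ x∈ → ∈-class⁺ (lookup-rot⁻ X (∈-class⁻ x∈)))
      (λ x∈ → ∈-class⁺ (lookup-rot⁺ X (∈-class⁻ x∈)))

    class-⊆ : ∀ {X Y : Point n} → X ≼ Y → ∀ i → class X i ⊆ class Y i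
    class-⊆ X≼Y i x∈ = ∈-class⁺ (X≼Y _ (∈-class⁻ x∈))

    spread : Point n → Fin p → ℕ
    spread X i = ∣ parts (class X i) ∣

    low : Point n → ℕ
    low X = proj₁ (minimum (spread X))

    low-isMin : ∀ X → IsMin (low X) (spread X)
    low-isMin X = proj₂ (minimum (spread X))

    equitable : Point n → ℕ
    equitable X = ∑ λ i → spread X i ⊓ suc (low X)

    spread-rot : ∀ X i → spread (rotPoint X) (rot i) ≡ spread X i
    spread-rot X i = cong (λ B → ∣ parts B ∣) (rot-class X i)

    low-rot : ∀ X → low (rotPoint X) ≡ low X
    low-rot X = sym (IsMin-unique {a = spread (rotPoint X)} isMin (low-isMin (rotPoint X)))
      where
      isMin : IsMin (low X) (spread (rotPoint X))
      isMin with low-isMin X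
      ... | low≤ , i , eq =
        (λ j → subst (λ z → low X ≤ spread (rotPoint X) z) (rot-rot⁻¹ j)
                 (ℕ.≤-trans (low≤ (rot⁻¹ j)) (ℕ.≤-reflexive (sym (spread-rot X (rot⁻¹ j)))))) ,
        rot i , trans (spread-rot X i) eq

    equitable-rot : ∀ X → equitable (rotPoint X) ≡ equitable X
    equitable-rot X = trans (sym (∑-rot (λ i → spread (rotPoint X) i ⊓ suc (low (rotPoint X)))))
      (∑-cong λ i → cong₂ (λ s m → s ⊓ suc m) (spread-rot X i) (low-rot X))

    big : Point n → Fin k → Subset p
    big X a = comprehend λ i → Big? a (class X i)

    big-rot : ∀ X a i → lookup (big (rotPoint X) a) (rot i) ≡ lookup (big X a) i
    big-rot X a i = begin
      lookup (big (rotPoint X) a) (rot i)              ≡⟨ Vec.lookup∘tabulate (λ i → does (Big? a (class (rotPoint X) i))) (rot i) ⟩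
      does (Big? a (class (rotPoint X) (rot i)))       ≡⟨ cong (λ B → does (Big? a B)) (rot-class X i) ⟩
      does (Big? a (class X i))                        ≡⟨ sym (Vec.lookup∘tabulate (λ i → does (Big? a (class X i))) i) ⟩
      lookup (big X a) i                               ∎
      where open ≡-Reasoning

    ∣big∣-rot : ∀ X a → ∣ big (rotPoint X) a ∣ ≡ ∣ big X a ∣
    ∣big∣-rot X a = ℕ.≤-antisym
      (∣∣-≤ (λ i j → rot j ≡ i)
        (λ {i} i∈ → rot⁻¹ i ,
          lookup⇒∈ (trans (sym (big-rot X a (rot⁻¹ i))) (trans (cong (lookup (big (rotPoint X) a)) (rot-rot⁻¹ i)) (∈⇒lookup i∈))) ,
          rot-rot⁻¹ i)
        (λ _ _ eq eq′ → trans (sym eq) eq′))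
      (∣∣-≤ (λ i j → rot i ≡ j)
        (λ {i} i∈ → rot i , lookup⇒∈ (trans (big-rot X a i) (∈⇒lookup i∈)) , refl)
        (λ _ _ eq eq′ → rot-injective (trans eq (sym eq′))))

    anyBig? : ∀ (X : Point n) a → Dec (∃ λ i → Big a (class X i))
    anyBig? X a = Fin.any? λ i → Big? a (class X i)

    colour : Point n → Maybe (Fin k)
    colour X = first λ a → does (anyBig? X a)

    colour-rot : ∀ X → colour (rotPoint X) ≡ colour X
    colour-rot X = first-cong λ a → does-cong (anyBig? (rotPoint X) a) (anyBig? X a)
      (λ { (i , b) → rot⁻¹ i , subst (Big a) (trans (cong (class (rotPoint X)) (sym (rot-rot⁻¹ i))) (rot-class X (rot⁻¹ i))) b })
      (λ { (i , b) → rot i , subst (Big a) (sym (rot-class X i)) b })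

    colour-just : ∀ {X a} → colour X ≡ just a → ∃ λ i → i ∈ big X a
    colour-just {X} {a} eq with does⇒ (anyBig? X a) (first-just (λ a → does (anyBig? X a)) eq)
    ... | i , b = i , ∈-comprehend⁺ (λ i → Big? a (class X i)) b

    not-all-big : ∀ X a → ¬ (∀ i → Big a (class X i))
    not-all-big X a b = monochromatic a (λ i → proj₁ (b i))
      ((λ {i} {j} x∈i x∈j → class-disjoint {X = X} (proj₁ (proj₂ (b i)) x∈i) (proj₁ (proj₂ (b j)) x∈j)) ,
       λ i → proj₁ (proj₂ (proj₂ (b i))))
      (λ i → proj₂ (proj₂ (proj₂ (b i))))

    some-not-big : ∀ X a → ∃ λ i → i ∉ big X a
    some-not-big X a with Fin.all? (λ i → Big? a (class X i))
    ... | yes all = contradiction all (not-all-big X a)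
    ... | no ¬all with Fin.¬∀⟶∃¬ p _ (λ i → Big? a (class X i)) ¬all
    ...   | i , ¬b = i , ¬b ∘ ∈-comprehend⁻ (λ i → Big? a (class X i))

    ∣big∣<p : ∀ X a → ∣ big X a ∣ < p
    ∣big∣<p X a = ∉⇒∣∣<n (proj₂ (some-not-big X a))

    -- Otherwise the representatives of the classes would form a solution, since no class contains a
    -- transversal from any `G a`.
    equitable-bound : ∀ {X} → colour X ≡ nothing → equitable X + q * k < n
    equitable-bound {X} eq = ℕ.≰⇒> λ n≤ → unsolvable record
      { family  = λ i → representatives (class X i)
      ; packing = (λ {i} {j} x∈i x∈j → class-disjoint {X = X} (representatives-⊆ {class X i} x∈i) (representatives-⊆ {class X j} x∈j)) ,
                  (λ i → representatives-transversal {class X i})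
      ; free    = λ a i g → does-false⇒ (anyBig? X a) (first-nothing (λ a → does (anyBig? X a)) eq a)
                    (i , representatives (class X i) , representatives-⊆ {class X i} , representatives-transversal {class X i} , g)
      ; level   = low X
      ; isMin   = (λ i → subst (low X ≤_) (sym (∣representatives∣ (class X i))) (proj₁ (low-isMin X) i)) ,
                  proj₁ (proj₂ (low-isMin X)) ,
                  trans (∣representatives∣ _) (proj₂ (proj₂ (low-isMin X)))
      ; bound   = subst (λ z → n ≤ z + q * k) (∑-cong λ i → cong (_⊓ suc (low X)) (sym (∣representatives∣ (class X i)))) n≤
      }

    blank : Point n
    blank = Vec.replicate n nothing

    colour-blank : colour blank ≡ nothing
    colour-blank with colour blank in eq
    ... | nothing = refl
    ... | just a with does⇒ (anyBig? blank a) (first-just (λ a → does (anyBig? blank a)) eq)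
    -- The set `C` lies in an empty class, and p copies of the empty set are a disjoint packing.
    ...   | i , C , C⊆ , _ , g = contradiction (λ _ → g) (monochromatic a (λ _ → C)
              ((λ x∈ _ → contradiction x∈ empty) , λ i x∈ _ _ → contradiction x∈ empty))
      where
      empty : ∀ {x} → x ∉ C
      empty {x} x∈ with () ← trans (sym (Vec.lookup-replicate x nothing)) (∈-class⁻ {X = blank} (C⊆ x∈))

    q*k<n : q * k < n
    q*k<n = ℕ.≤-<-trans (ℕ.m≤n+m (q * k) (equitable blank)) (equitable-bound {blank} colour-blank)

    -- The number of values left for points without a colour, when each of the `k` colours takes `q`
    -- of n - 1 values. By `q*k<n` the subtraction is not cut off.
    α : ℕ
    α = n ∸ suc (q * k)

    α-bound : α + k * q < n
    α-bound = ℕ.≤-reflexive (begin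
      suc (α + k * q)      ≡⟨ sym (ℕ.+-suc α (k * q)) ⟩
      α + suc (k * q)      ≡⟨ cong (λ z → α + suc z) (ℕ.*-comm k q) ⟩
      α + suc (q * k)      ≡⟨ ℕ.m∸n+n≡m q*k<n ⟩
      n                    ∎)
      where open ≡-Reasoning

    equitable≤α : ∀ {X} → colour X ≡ nothing → equitable X ≤ α
    equitable≤α {X} eq = ℕ.m+n≤o⇒m≤o∸n (equitable X)
      (ℕ.≤-trans (ℕ.≤-reflexive (ℕ.+-suc (equitable X) (q * k))) (equitable-bound eq))

    0<equitable : ∀ {X} → Nonzero X → 0 < equitable X
    0<equitable {X} (x , i , eq) = ℕ.≤-trans
      (ℕ.⊓-glb (∈⇒0<∣∣ (∈-comprehend⁺ (meets? (class X i)) (x , ∈-class⁺ eq , refl))) (s≤s z≤n))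
      (term≤∑ (λ i → spread X i ⊓ suc (low X)) i)

    -- Uncoloured points take values below `α`, and colour `a` occupies the block of `q` values
    -- starting at α + a q. The shifts by one lose nothing, because both counts are positive at the
    -- nonzero points concerned.
    val′ : Point n → Maybe (Fin k) → ℕ
    val′ X (just a) = α + ((∣ big X a ∣ ∸ 1) + toℕ a * q)
    val′ X nothing  = equitable X ∸ 1

    val : Point n → ℕ
    val X = val′ X (colour X)

    val-rot : ∀ X → val (rotPoint X) ≡ val X
    val-rot X = trans (cong (val′ (rotPoint X)) (colour-rot X)) (lem (colour X))
      where
      lem : ∀ c → val′ (rotPoint X) c ≡ val′ X c
      lem (just a) = cong (λ z → α + ((z ∸ 1) + toℕ a * q)) (∣big∣-rot X a)
      lem nothing  = cong (_∸ 1) (equitable-rot X)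

    ∸1<q : ∀ X a → ∣ big X a ∣ ∸ 1 < q
    ∸1<q X a with ∣ big X a ∣ | ∣big∣<p X a
    ... | zero  | _       = 1≤q
    ... | suc m | s≤s m<q = m<q

    equitable∸1<α : ∀ {X} → Nonzero X → colour X ≡ nothing → equitable X ∸ 1 < α
    equitable∸1<α {X} nz eq with equitable X | 0<equitable {X} nz | equitable≤α {X} eq
    ... | suc m | _ | m<α = m<α

    val-bound : ∀ {X} → Nonzero X → val X < α + k * q
    val-bound {X} nz with colour X in eq
    ... | nothing = ℕ.<-≤-trans (equitable∸1<α {X} nz eq) (ℕ.m≤m+n α (k * q))
    ... | just a  = ℕ.+-monoʳ-< α (ℕ.<-≤-trans (ℕ.+-monoˡ-< (toℕ a * q) (∸1<q X a)) (ℕ.*-monoˡ-≤ q (Fin.toℕ<n a)))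

    high : Point n → Fin p → Bool
    high X i = does (low X ℕ.<? spread X i)

    inPart : Point n → Fin l → Fin p → Bool
    inPart X j i = lookup (parts (class X i)) j

    single : Point n → Fin p → Bool
    single X i = does (Maybe.≡-dec Fin._≟_ (firstColour X) (just i))

    firstMixed : Point n → Maybe (Fin l)
    firstMixed X = first λ j → does (mixed? (inPart X j))

    -- Each candidate is used only when the earlier ones are empty or everything. The last one, a
    -- singleton, is always proper and nonempty at a nonzero point.
    small : Point n → Fin p → Bool
    small X i = if does (mixed? (high X)) then high X i else maybe′ (λ j → inPart X j i) (single X i) (firstMixed X)

    -- Serves both equivariance, with `σ` the rotation, and consistency, with `σ` the identity.
    -- Agreement of a later candidate is demanded only where the earlier ones fail, since comparable
    -- points agree there only under that assumption.
    small-transfer : ∀ X Y (σ σ⁻¹ : Fin p → Fin p) → (∀ i → σ (σ⁻¹ i) ≡ i) →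
      (∀ i → high Y (σ i) ≡ high X i) →
      (¬ Mixed (high X) → ∀ j i → inPart Y j (σ i) ≡ inPart X j i) →
      (¬ Mixed (high X) → (∀ j → ¬ Mixed (inPart X j)) → ∀ i → single Y (σ i) ≡ single X i) →
      ∀ i → small Y (σ i) ≡ small X i
    small-transfer X Y σ σ⁻¹ σσ⁻¹ high-eq part-eq single-eq i = cases (mixed? (high X))
      where
      to : Mixed (high X) → Mixed (high Y)
      to = Mixed-transfer {S = high X} σ high-eq
      from : Mixed (high Y) → Mixed (high X)
      from = Mixed-transfer {S = high Y} σ⁻¹ λ i → trans (sym (high-eq (σ⁻¹ i))) (cong (high Y) (σσ⁻¹ i))
      module _ (¬m : ¬ Mixed (high X)) where
        same : firstMixed Y ≡ firstMixed X
        same = first-cong λ j → does-cong (mixed? (inPart Y j)) (mixed? (inPart X j))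
          (Mixed-transfer {S = inPart Y j} σ⁻¹ (λ i → trans (sym (part-eq ¬m j (σ⁻¹ i))) (cong (inPart Y j) (σσ⁻¹ i))))
          (Mixed-transfer {S = inPart X j} σ (part-eq ¬m j))
        rest : ∀ c → firstMixed X ≡ c →
               maybe′ (λ j → inPart Y j (σ i)) (single Y (σ i)) c ≡ maybe′ (λ j → inPart X j i) (single X i) c
        rest (just j) _  = part-eq ¬m j i
        rest nothing  eq = single-eq ¬m (λ j → does-false⇒ (mixed? (inPart X j)) (first-nothing (λ j → does (mixed? (inPart X j))) eq j)) i
      cases : Dec (Mixed (high X)) → small Y (σ i) ≡ small X i
      cases (yes m) = trans (if-yes (mixed? (high Y)) (to m)) (trans (high-eq i) (sym (if-yes (mixed? (high X)) m)))
      cases (no ¬m) = trans (if-no (mixed? (high Y)) (¬m ∘ from)) (trans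
        (trans (cong (maybe′ (λ j → inPart Y j (σ i)) (single Y (σ i))) (same ¬m)) (rest ¬m (firstMixed X) refl))
        (sym (if-no (mixed? (high X)) ¬m)))

    firstColour-rot : ∀ {m} (X : Point m) → firstColour (rotPoint X) ≡ Maybe.map rot (firstColour X)
    firstColour-rot []            = refl
    firstColour-rot (just i ∷ X)  = refl
    firstColour-rot (nothing ∷ X) = firstColour-rot X

    small-rot : ∀ X i → small (rotPoint X) (rot i) ≡ small X i
    small-rot X = small-transfer X (rotPoint X) rot rot⁻¹ rot-rot⁻¹
      (λ i → cong₂ (λ m s → does (m ℕ.<? s)) (low-rot X) (spread-rot X i))
      (λ _ j i → cong (λ B → lookup (parts B) j) (rot-class X i))
      (λ _ _ i → does-cong (Maybe.≡-dec Fin._≟_ _ _) (Maybe.≡-dec Fin._≟_ _ _)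
        (λ eq → unrot (firstColour X) (trans (sym (firstColour-rot X)) eq))
        (λ eq → trans (firstColour-rot X) (cong (Maybe.map rot) eq)))
      where
      unrot : ∀ m {i} → Maybe.map rot m ≡ just (rot i) → m ≡ just i
      unrot (just j) eq = cong just (rot-injective (Maybe.just-injective eq))

    small-mixed : ∀ {X} → Nonzero X → Mixed (small X)
    small-mixed {X} (x , i , eq) = cases (mixed? (high X))
      where
      rest : ∀ c → firstMixed X ≡ c → Mixed (λ i → maybe′ (λ j → inPart X j i) (single X i) c)
      rest (just j) eq′ = does⇒ (mixed? (inPart X j)) (first-just (λ j → does (mixed? (inPart X j))) eq′)
      rest nothing  _ with firstColour-just {X = X} {x} eq
      ... | i₀ , eq₀ =
        (i₀ , dec-true (Maybe.≡-dec Fin._≟_ _ _) eq₀) ,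
        (proj₁ (another 1≤q i₀) , dec-false (Maybe.≡-dec Fin._≟_ _ _) λ eq₁ →
          proj₂ (another 1≤q i₀) (Maybe.just-injective (trans (sym eq₀) eq₁)))
      cases : Dec (Mixed (high X)) → Mixed (small X)
      cases (yes m) = Mixed-transfer {S = high X} id (λ i → if-yes (mixed? (high X)) m) m
      cases (no ¬m) = Mixed-transfer id (λ i → if-no (mixed? (high X)) ¬m) (rest (firstMixed X) refl)

    signs′ : Point n → Maybe (Fin k) → Fin p → Bool
    signs′ X (just a) i = lookup (big X a) i
    signs′ X nothing  i = small X i

    signs : Point n → Fin p → Bool
    signs X = signs′ X (colour X)

    signs-rot : ∀ X i → signs (rotPoint X) (rot i) ≡ signs X i
    signs-rot X i = trans (cong (λ c → signs′ (rotPoint X) c (rot i)) (colour-rot X)) (lem (colour X))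
      where
      lem : ∀ c → signs′ (rotPoint X) c (rot i) ≡ signs′ X c i
      lem (just a) = big-rot X a i
      lem nothing  = small-rot X i

    ∉⇒lookup : ∀ {m} {B : Subset m} {x} → x ∉ B → lookup B x ≡ false
    ∉⇒lookup {B = B} {x} x∉ with lookup B x in eq
    ... | true  = contradiction (lookup⇒∈ eq) x∉
    ... | false = refl

    signs-mixed : ∀ {X} → Nonzero X → Mixed (signs X)
    signs-mixed {X} nz with colour X in eq
    ... | nothing = small-mixed nz
    ... | just a  = Product.map₂ ∈⇒lookup (colour-just {X} eq) , Product.map₂ ∉⇒lookup (some-not-big X a)

    module Consistency {X Y : Point n} (X≼Y : X ≼ Y) where

      spread-≤ : ∀ i → spread X i ≤ spread Y i
      spread-≤ i = p⊆q⇒∣p∣≤∣q∣ (parts-⊆ (class-⊆ X≼Y i))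

      low-≤ : low X ≤ low Y
      low-≤ with low-isMin Y
      ... | _ , i , eq = ℕ.≤-trans (proj₁ (low-isMin X) i) (ℕ.≤-trans (spread-≤ i) (ℕ.≤-reflexive eq))

      module _ (eq : equitable X ≡ equitable Y) where

        -- Every summand can only grow from `X` to `Y`, so equal sums force equal summands.
        truncated-≡ : ∀ i → spread X i ⊓ suc (low X) ≡ spread Y i ⊓ suc (low Y)
        truncated-≡ = ∑-≤-≡⇒≗ (λ i → ℕ.⊓-mono-≤ (spread-≤ i) (s≤s low-≤)) eq

        low-≡ : low X ≡ low Y
        low-≡ with ℕ.m≤n⇒m<n∨m≡n low-≤ | low-isMin X
        ... | inj₂ same | _ = same
        -- A class attaining `low X` has truncated size at most `low X` in `X`, but at least `low Y`
        -- in `Y`.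
        ... | inj₁ lt   | _ , i , eq′ = contradiction
          (ℕ.⊓-glb (proj₁ (low-isMin Y) i) (ℕ.n≤1+n (low Y)))
          (ℕ.<⇒≱ (begin-strict
            spread Y i ⊓ suc (low Y)   ≡⟨ sym (truncated-≡ i) ⟩
            spread X i ⊓ suc (low X)   ≤⟨ ℕ.m⊓n≤m _ _ ⟩
            spread X i                 ≡⟨ eq′ ⟩
            low X                      <⟨ lt ⟩
            low Y                      ∎))
          where open ℕ.≤-Reasoning

        high-≡ : ∀ i → high Y i ≡ high X i
        high-≡ i = does-cong (low Y ℕ.<? spread Y i) (low X ℕ.<? spread X i)
          (λ lt → begin-strict
            low X                       <⟨ ℕ.n<1+n (low X) ⟩
            suc (low X)                 ≡⟨ cong suc low-≡ ⟩
            suc (low Y)                 ≡⟨ sym (ℕ.m≥n⇒m⊓n≡n lt) ⟩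
            spread Y i ⊓ suc (low Y)    ≡⟨ sym (truncated-≡ i) ⟩
            spread X i ⊓ suc (low X)    ≤⟨ ℕ.m⊓n≤m _ _ ⟩
            spread X i                  ∎)
          (λ lt → subst (_< spread Y i) low-≡ (ℕ.<-≤-trans lt (spread-≤ i)))
          where open ℕ.≤-Reasoning

        module _ (¬mixed : ¬ Mixed (high X)) where

          -- The class attaining the minimum is never high, so if the high classes are not a mixed
          -- set, there are none.
          spread-low : ∀ i → spread X i ≤ low X
          spread-low i = ℕ.≮⇒≥ λ lt → ¬mixed
            ((i , dec-true (low X ℕ.<? spread X i) lt) ,
             (i₀ , dec-false (low X ℕ.<? spread X i₀) (ℕ.≤⇒≯ (ℕ.≤-reflexive eq₀))))
            where
            i₀ = proj₁ (proj₂ (low-isMin X))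
            eq₀ = proj₂ (proj₂ (low-isMin X))

          spread-low′ : ∀ i → spread Y i ≤ low Y
          spread-low′ i = ℕ.≮⇒≥ λ lt → ℕ.<⇒≱
            (does⇒ (low X ℕ.<? spread X i) (trans (sym (high-≡ i)) (dec-true (low Y ℕ.<? spread Y i) lt)))
            (spread-low i)

          -- All classes of both points meet exactly the common minimum number of parts, and the
          -- parts met by `X` are among those met by `Y`.
          parts-≡ : ∀ i → parts (class Y i) ≡ parts (class X i)
          parts-≡ i = ⊆-antisym
            (⊆-∣∣⇒⊇ (parts-⊆ (class-⊆ X≼Y i)) (ℕ.≤-trans (spread-low′ i)
              (ℕ.≤-trans (ℕ.≤-reflexive (sym low-≡)) (proj₁ (low-isMin X) i))))
            (parts-⊆ (class-⊆ X≼Y i))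

          -- A part which meets every class of X has p elements, all of them coloured by X.
          saturated : (∀ j → ¬ Mixed (inPart X j)) → Y ≼ X
          saturated ¬mixed′ x {i} eq = subst (λ z → lookup X x ≡ just z) i′≡i eq′
            where
            j = π x
            in-i : inPart X j i ≡ true
            in-i = trans (cong (λ B → lookup B j) (sym (parts-≡ i)))
              (∈⇒lookup (∈-comprehend⁺ (meets? (class Y i)) (x , ∈-class⁺ eq , refl)))
            in-all : ∀ i → inPart X j i ≡ true
            in-all i′ with inPart X j i′ in eq′
            ... | true  = refl
            ... | false = contradiction ((i , in-i) , (i′ , eq′)) (¬mixed′ j)
            witness : ∀ i → ∃ λ y → y ∈ class X i × π y ≡ j
            witness i = ∈-comprehend⁻ (meets? (class X i)) (lookup⇒∈ (in-all i))
            ranks : Fin (suc p) → Fin p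
            ranks zero    = ρ x
            ranks (suc i) = ρ (proj₁ (witness i))
            hit : (∃ λ i → lookup X x ≡ just i)
            -- Among `x` and the p witnesses two have the same rank in one part and so coincide.
            -- Witnesses from different classes are distinct, so one of them is `x`.
            hit with Fin.pigeonhole (ℕ.n<1+n p) ranks
            ... | zero , suc i , _ , same with witness i | same
            ...   | y , y∈ , eq-π | same′ with π-ρ-injective {x} {y} (sym eq-π) same′
            ...     | refl = i , ∈-class⁻ y∈
            hit | suc i , suc i′ , lt , same with witness i | witness i′ | same
            ...   | y , y∈ , eq-π | y′ , y′∈ , eq-π′ | same′ with π-ρ-injective {y} {y′} (trans eq-π (sym eq-π′)) same′
            ...     | refl = contradiction (cong suc (class-disjoint {X = X} y∈ y′∈)) (Fin.<⇒≢ lt)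
            eq′ = proj₂ hit
            i′≡i : proj₁ hit ≡ i
            i′≡i = Maybe.just-injective (trans (sym (X≼Y x eq′)) eq)

          X≡Y : (∀ j → ¬ Mixed (inPart X j)) → X ≡ Y
          X≡Y ¬mixed′ = lookup-injective λ x → ≼-antisym x (lookup X x) refl
            where
            ≼-antisym : ∀ x c → lookup X x ≡ c → lookup X x ≡ lookup Y x
            ≼-antisym x (just i) eq = trans eq (sym (X≼Y x eq))
            ≼-antisym x nothing eq with lookup Y x in eq′
            ... | nothing = eq
            ... | just i  = contradiction (trans (sym eq) (saturated ¬mixed′ x eq′)) λ ()

        small-≡ : ∀ i → small Y i ≡ small X i
        small-≡ = small-transfer X Y id id (λ _ → refl) high-≡
          (λ ¬mixed j i → cong (λ B → lookup B j) (parts-≡ ¬mixed i))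
          (λ ¬mixed ¬mixed′ i → cong (λ Z → single Z i) (sym (X≡Y ¬mixed ¬mixed′)))

      big-≡ : ∀ {a} → ∣ big X a ∣ ≡ ∣ big Y a ∣ → big X a ≡ big Y a
      big-≡ {a} eq = ⊆-antisym big-⊆ (⊆-∣∣⇒⊇ big-⊆ (ℕ.≤-reflexive (sym eq)))
        where
        big-⊆ : big X a ⊆ big Y a
        big-⊆ {i} i∈ = ∈-comprehend⁺ (λ i → Big? a (class Y i))
          (Big-⊆ (class-⊆ X≼Y i) (∈-comprehend⁻ (λ i → Big? a (class X i)) i∈))

      private
        instance
          q≢0 : NonZero q
          q≢0 = >-nonZero 1≤q

        digits : ∀ {c c′ a a′} → c < q → c′ < q → c + a * q ≡ c′ + a′ * q → c ≡ c′ × a ≡ a′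
        digits {c} {c′} {a} {a′} c<q c′<q eq = c≡c′ , ℕ.*-cancelʳ-≡ a a′ q
          (ℕ.+-cancelˡ-≡ c _ _ (trans eq (cong (_+ a′ * q) (sym c≡c′))))
          where
          c≡c′ : c ≡ c′
          c≡c′ = begin
            c                  ≡⟨ sym (m<n⇒m%n≡m c<q) ⟩
            c % q              ≡⟨ sym ([m+kn]%n≡m%n c a q) ⟩
            (c + a * q) % q    ≡⟨ cong (_% q) eq ⟩
            (c′ + a′ * q) % q  ≡⟨ [m+kn]%n≡m%n c′ a′ q ⟩
            c′ % q             ≡⟨ m<n⇒m%n≡m c′<q ⟩
            c′                 ∎
            where open ≡-Reasoning

        ∸1-injective : ∀ {m m′} → 0 < m → 0 < m′ → m ∸ 1 ≡ m′ ∸ 1 → m ≡ m′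
        ∸1-injective (s≤s _) (s≤s _) eq = cong suc eq

      signs-≡ : Nonzero X → Nonzero Y → val X ≡ val Y → ∀ i → signs X i ≡ signs Y i
      signs-≡ nzX nzY eq i with colour X in cX | colour Y in cY
      ... | nothing | nothing = sym (small-≡ (∸1-injective (0<equitable nzX) (0<equitable nzY) eq) i)
      ... | nothing | just a  = contradiction (equitable∸1<α nzX cX) (ℕ.≤⇒≯ (ℕ.≤-trans (ℕ.m≤m+n α _) (ℕ.≤-reflexive (sym eq))))
      ... | just a  | nothing = contradiction (equitable∸1<α nzY cY) (ℕ.≤⇒≯ (ℕ.≤-trans (ℕ.m≤m+n α _) (ℕ.≤-reflexive eq)))
      ... | just a  | just b with digits {a = toℕ a} {toℕ b} (∸1<q X a) (∸1<q Y b) (ℕ.+-cancelˡ-≡ α _ _ eq)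
      ...   | eq-c , eq-a with Fin.toℕ-injective eq-a
      ...     | refl = cong (λ B → lookup B i) (big-≡ (∸1-injective (∈⇒0<∣∣ (proj₂ (colour-just {X} cX))) (∈⇒0<∣∣ (proj₂ (colour-just {Y} cY))) eq-c))

    impossible : n ≤ α + k * q
    impossible = SmallTucker.tucker-ℕ q (α + k * q) 1≤q
      (choose ∘ signs) val val-bound (λ {X} _ → val-rot X)
      (λ {X} nz → choose-rot {signs X} {signs (rotPoint X)} (signs-rot X) p-prime (signs-mixed nz))
      (λ {X} {Y} nzX nzY X≼Y eq → choose-cong {signs X} {signs Y} (Consistency.signs-≡ X≼Y nzX nzY eq))

    absurd : n < n
    absurd = ℕ.≤-<-trans impossible α-bound

open JoinChains
open Families
open CompositeUniformity
open EquivariantChoice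
open PrimeUniformity
open import Data.Bool using (Bool; true; false; if_then_else_; T)
open import Data.Nat as ℕ using (ℕ; zero; suc; _+_; _*_; _∸_; _≤_; _<_; _⊓_; z≤n; s≤s; nonTrivial⇒n>1; n>1⇒nonTrivial)
import Data.Nat.Properties as ℕ
open import Data.Nat.DivMod using (m<n*o⇒m/o<n)
open import Data.Nat.Divisibility using (divides)
open import Data.Nat.Induction using (<-rec)
open import Data.Nat.Primality using (Prime; prime?; composite; ¬prime⇒composite)
open import Data.Fin as Fin using (Fin; zero; suc; toℕ; fromℕ<; splitAt)
import Data.Fin.Properties as Fin
open import Data.Fin.Subset using (Subset; _∈_; _⊆_; _∩_; ∣_∣; Nonempty; ⊤)
open import Data.Fin.Subset.Properties using (_∈?_; _⊆?_; anySubset?; ∣⊤∣≡n; ∈⊤; x∈p∩q⁻)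
open import Data.Maybe as Maybe using (Maybe; just; nothing)
import Data.Maybe.Properties as Maybe
open import Data.Vec as Vec using (Vec; lookup; tabulate; []; _∷_; here; there)
import Data.Vec.Properties as Vec
open import Data.Product as Product using (Σ; ∃; _×_; _,_; proj₁; proj₂; uncurry)
open import Data.Sum using (inj₁; inj₂; [_,_]′)
open import Function using (_∘_)
open import Relation.Nullary using (¬_; Dec; yes; no; contradiction)
open import Relation.Nullary.Decidable using (map′; _×-dec_; T?; ¬?)
open import Relation.Binary.PropositionalEquality

-- Decidability of solutions, all uniformities, and ranks of copies

module _ {n l k q : ℕ} (π : Fin n → Fin l) (G : Fin k → Subset n → Set)
         (G? : ∀ a B → Dec (G a B)) where

  private
    Good : Colouring (suc q) n → Set
    Good X = (∀ i → Transversal π (class X i)) × (∀ a i → ¬ G a (class X i)) ×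
      n ≤ ∑ (λ i → ∣ class X i ∣ ⊓ suc (proj₁ (minimum (λ i → ∣ class X i ∣)))) + q * k

    good? : ∀ X → Dec (Good X)
    good? X = Fin.all? (λ i → transversal? π (class X i)) ×-dec
      (Fin.all? (λ a → Fin.all? λ i → ¬? (G? a (class X i))) ×-dec (n ℕ.≤? _))

    good⇒solution : ∃ Good → Solution q π G
    good⇒solution (X , t , free , bound) = record
      { family  = class X
      ; packing = class-disjoint {X = X} , t
      ; free    = free
      ; level   = proj₁ (minimum λ i → ∣ class X i ∣)
      ; isMin   = proj₂ (minimum λ i → ∣ class X i ∣)
      ; bound   = bound
      }

    solution⇒good : Solution q π G → ∃ Good
    solution⇒good S = paint family ,
      (λ i → subst (Transversal π) (sym (eq i)) (proj₂ packing i)) ,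
      (λ a i → free a i ∘ subst (G a) (eq i)) ,
      subst (λ z → n ≤ z + q * k)
        (∑-cong λ i → cong₂ (λ B w → ∣ B ∣ ⊓ suc w) (sym (eq i)) level≡) bound
      where
      open Solution S
      eq : ∀ i → class (paint family) i ≡ family i
      eq = class-paint {C = family} (proj₁ packing)
      level≡ : level ≡ proj₁ (minimum (λ i → ∣ class (paint family) i ∣))
      level≡ = IsMin-unique {a = λ i → ∣ class (paint family) i ∣}
        ((λ i → subst (λ B → level ≤ ∣ B ∣) (sym (eq i)) (proj₁ isMin i)) ,
         proj₁ (proj₂ isMin) , trans (cong ∣_∣ (eq (proj₁ (proj₂ isMin)))) (proj₂ (proj₂ isMin)))
        (proj₂ (minimum (λ i → ∣ class (paint family) i ∣)))

  -- Lets the argument by contradiction in the prime case produce an actual solution. Families are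
  -- searched as colourings, and uniqueness of the minimum identifies the level.
  solution? : Dec (Solution q π G)
  solution? = map′ good⇒solution solution⇒good (anyColouring? good?)

Bound-prime : ∀ {q} → 1 ≤ q → Prime (suc q) → Bound q
Bound-prime {q} 1≤q p-prime π ρ π-ρ-injective G G? monochromatic with solution? {q = q} π G G?
... | yes S = S
... | no ¬S = contradiction
  (PrimeCase.absurd q 1≤q p-prime π ρ π-ρ-injective G G? monochromatic ¬S) (ℕ.<-irrefl refl)

Bound-all : ∀ d → 1 ≤ d → Bound d
Bound-all = <-rec (λ d → 1 ≤ d → Bound d) step
  where
  step : ∀ d → (∀ {d′} → d′ < d → 1 ≤ d′ → Bound d′) → 1 ≤ d → Bound d
  step d rec 1≤d with prime? (suc d)
  ... | yes p-prime = Bound-prime 1≤d p-prime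
  ... | no ¬prime with ¬prime⇒composite {{n>1⇒nonTrivial (s≤s 1≤d)}} ¬prime
  ...   | composite {m} m<r (divides t eq) = factors m t (nonTrivial⇒n>1 m) m<r eq
    where
    factors : ∀ m t → 1 < m → m < suc d → suc d ≡ t * m → Bound d
    factors m zero                _             _    ()
    factors m (suc zero)          _             m<r eq = contradiction (trans eq (ℕ.+-identityʳ m)) (ℕ.>⇒≢ m<r)
    factors (suc d₁) (suc (suc t)) (s≤s 1≤d₁) m<r eq =
      subst Bound (sym (ℕ.suc-injective eq)) (Bound-* (rec (ℕ.s≤s⁻¹ m<r) 1≤d₁) (rec t<d (s≤s z≤n)))
      where
      t<d : suc t < d
      t<d = ℕ.s≤s⁻¹ (subst (suc (suc t) <_) (sym eq) (ℕ.m<m*n (suc (suc t)) (suc d₁) (s≤s 1≤d₁)))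

-- The ground set with multiplicities consists of the copies (i , c), c < s i, of the elements i.
copyOf : ∀ {n} (s : Fin n → ℕ) → Fin (nbar s) → Fin n × ℕ
copyOf {suc n} s x =
  [ (λ c → zero , toℕ c) , (λ y → Product.map₁ suc (copyOf (s ∘ suc) y)) ]′ (splitAt (s zero) x)

copyOf-< : ∀ {n} (s : Fin n → ℕ) x → proj₂ (copyOf s x) < s (proj₁ (copyOf s x))
copyOf-< {suc n} s x with splitAt (s zero) x
... | inj₁ c = Fin.toℕ<n c
... | inj₂ y = copyOf-< (s ∘ suc) y

copyOf-injective : ∀ {n} (s : Fin n → ℕ) {x y} → copyOf s x ≡ copyOf s y → x ≡ y
copyOf-injective {suc n} s {x} {y} eq
  with splitAt (s zero) x in eqx | splitAt (s zero) y in eqy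
... | inj₁ c | inj₁ c′ = trans (sym (Fin.splitAt⁻¹-↑ˡ eqx))
  (trans (cong (Fin._↑ˡ _) (Fin.toℕ-injective (cong proj₂ eq))) (Fin.splitAt⁻¹-↑ˡ eqy))
... | inj₁ c | inj₂ y′ = contradiction (cong proj₁ eq) λ ()
... | inj₂ x′ | inj₁ c = contradiction (cong proj₁ eq) λ ()
... | inj₂ x′ | inj₂ y′ = trans (sym (Fin.splitAt⁻¹-↑ʳ eqx))
  (trans (cong (s zero Fin.↑ʳ_) (copyOf-injective (s ∘ suc)
    (cong₂ _,_ (Fin.suc-injective (cong proj₁ eq)) (cong proj₂ eq)))) (Fin.splitAt⁻¹-↑ʳ eqy))

-- Defs does not export the summand of wt; unification recovers it.
private
  weight-terms : ∀ {n} (s : Fin n → ℕ) (P : Subset n) → Σ (Fin n → ℕ) λ f → wt s P ≡ ∑ f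
  weight-terms s P = _ , refl

  weight-term : ∀ {n} (s : Fin n → ℕ) (P : Subset n) i →
                proj₁ (weight-terms s P) i ≡ (if lookup P i then s i else 0)
  weight-term s P i with lookup P i
  ... | true  = refl
  ... | false = refl

wt-if : ∀ {n} (s : Fin n → ℕ) (P : Subset n) → wt s P ≡ ∑ λ i → if lookup P i then s i else 0
wt-if s P = ∑-cong (weight-term s P)

-- The total multiplicity of the elements of `P` before the given one. Listing the copies of a part
-- consecutively, copy c of i stands at position offset + c, which is below the weight of the part.
offset : ∀ {n} → (Fin n → ℕ) → Subset n → Fin n → ℕ
offset s (b ∷ P) zero    = 0
offset s (b ∷ P) (suc i) = (if b then s zero else 0) + offset (s ∘ suc) P i

offset-< : ∀ {n} (s : Fin n → ℕ) {P i c} → i ∈ P → c < s i →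
           offset s P i + c < ∑ λ i → if lookup P i then s i else 0
offset-< s {true ∷ P} {zero} here c< = ℕ.<-≤-trans c< (ℕ.m≤m+n (s zero) _)
offset-< s {b ∷ P} {suc i} {c} (there i∈) c< = ℕ.≤-<-trans
  (ℕ.≤-reflexive (ℕ.+-assoc (if b then s zero else 0) (offset (s ∘ suc) P i) c))
  (ℕ.+-monoʳ-< (if b then s zero else 0) (offset-< (s ∘ suc) i∈ c<))

-- The copies of different elements of `P` occupy disjoint intervals of positions.
offset-injective : ∀ {n} (s : Fin n → ℕ) {P i i′ c c′} → i ∈ P → i′ ∈ P → c < s i → c′ < s i′ →
                   offset s P i + c ≡ offset s P i′ + c′ → i ≡ i′ × c ≡ c′
offset-injective s here here c< c′< eq = refl , eq
offset-injective s {c = c} {c′} here (there {i = i′} {xs = P} i′∈) c< c′< eq = contradiction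
  (ℕ.≤-trans (ℕ.m≤m+n (s zero) (offset (s ∘ suc) P i′)) (ℕ.≤-trans (ℕ.m≤m+n _ c′) (ℕ.≤-reflexive (sym eq)))) (ℕ.<⇒≱ c<)
offset-injective s {c = c} {c′} (there {i = i} {xs = P} i∈) here c< c′< eq = contradiction
  (ℕ.≤-trans (ℕ.m≤m+n (s zero) (offset (s ∘ suc) P i)) (ℕ.≤-trans (ℕ.m≤m+n _ c) (ℕ.≤-reflexive eq))) (ℕ.<⇒≱ c′<)
offset-injective s {b ∷ P} {c = c} {c′} (there {i = i} i∈) (there {i = i′} i′∈) c< c′< eq = Product.map₁ (cong suc)
  (offset-injective (s ∘ suc) i∈ i′∈ c< c′< (ℕ.+-cancelˡ-≡ t _ _
    (trans (sym (ℕ.+-assoc t (offset (s ∘ suc) P i) c)) (trans eq (ℕ.+-assoc t (offset (s ∘ suc) P i′) c′)))))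
  where t = if b then s zero else 0

take : ∀ {n} → ℕ → Subset n → Subset n
take t       []          = []
take t       (false ∷ B) = false ∷ take t B
take zero    (true ∷ B)  = false ∷ take zero B
take (suc t) (true ∷ B)  = true ∷ take t B

take-⊆ : ∀ {n} t (B : Subset n) → take t B ⊆ B
take-⊆ t       (false ∷ B) (there p) = there (take-⊆ t B p)
take-⊆ zero    (true ∷ B)  (there p) = there (take-⊆ zero B p)
take-⊆ (suc t) (true ∷ B)  here      = here
take-⊆ (suc t) (true ∷ B)  (there p) = there (take-⊆ t B p)

∣take∣ : ∀ {n} t (B : Subset n) → ∣ take t B ∣ ≡ ∣ B ∣ ⊓ t
∣take∣ t       []          = refl
∣take∣ t       (false ∷ B) = ∣take∣ t B
∣take∣ zero    (true ∷ B)  = trans (∣take∣ zero B) (ℕ.⊓-zeroʳ ∣ B ∣)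
∣take∣ (suc t) (true ∷ B)  = cong suc (∣take∣ t B)

ceilDiv-≤ : ∀ {e k} d → 1 ≤ d → e ≤ d * k → ceilDiv e d ≤ k
ceilDiv-≤ {e} {k} (suc d) _ e≤ = ℕ.s≤s⁻¹ (m<n*o⇒m/o<n {e + d} {suc k} {suc d} (begin-strict
  e + d                  ≤⟨ ℕ.+-monoˡ-≤ d e≤ ⟩
  suc d * k + d          <⟨ ℕ.+-monoʳ-< (suc d * k) (ℕ.n<1+n d) ⟩
  suc d * k + suc d      ≡⟨ ℕ.+-comm (suc d * k) (suc d) ⟩
  suc d + suc d * k      ≡⟨ cong (suc d +_) (ℕ.*-comm (suc d) k) ⟩
  suc k * suc d          ∎))
  where open ℕ.≤-Reasoning

-- From proper colourings of the hypergraph to packings of copies, and back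

module Copies {n l d k} (s : Fin n → ℕ) (F : Subset n → Bool) (P : Fin l → Subset n)
         (partition : IsPartition P) (light : ∀ j → wt s (P j) ≤ suc d)
         (c : KGVertex F P → Fin k) (proper : ProperKG (suc d) s F P k c) where

  part : Fin n → Fin l
  part i = proj₁ (proj₂ partition i)

  ∈-part : ∀ i → i ∈ P (part i)
  ∈-part i = proj₁ (proj₂ (proj₂ partition i))

  part-unique : ∀ {i j} → i ∈ P j → j ≡ part i
  part-unique {i} {j} = proj₂ (proj₂ (proj₂ partition i)) j

  base : Fin (nbar s) → Fin n
  base x = proj₁ (copyOf s x)

  π : Fin (nbar s) → Fin l
  π = part ∘ base

  rank : Fin (nbar s) → ℕ
  rank x = offset s (P (π x)) (base x) + proj₂ (copyOf s x)

  rank-< : ∀ x → rank x < suc d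
  rank-< x = ℕ.<-≤-trans (offset-< s (∈-part (base x)) (copyOf-< s x))
    (ℕ.≤-trans (ℕ.≤-reflexive (sym (wt-if s (P (π x))))) (light (π x)))

  ρ : Fin (nbar s) → Fin (suc d)
  ρ x = fromℕ< (rank-< x)

  π-ρ-injective : ∀ {x y} → π x ≡ π y → ρ x ≡ ρ y → x ≡ y
  π-ρ-injective {x} {y} eq-π eq-ρ = copyOf-injective s (uncurry (cong₂ _,_)
    (offset-injective s {P = P (π y)} (subst (λ j → base x ∈ P j) eq-π (∈-part (base x))) (∈-part (base y))
      (copyOf-< s x) (copyOf-< s y)
      (trans (cong (λ j → offset s (P j) (base x) + proj₂ (copyOf s x)) (sym eq-π))
        (trans (sym (Fin.toℕ-fromℕ< (rank-< x))) (trans (cong toℕ eq-ρ) (Fin.toℕ-fromℕ< (rank-< y)))))))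

  over? : ∀ B i → Dec (∃ λ x → x ∈ B × base x ≡ i)
  over? B i = Fin.any? λ x → (x ∈? B) ×-dec (base x Fin.≟ i)

  project : Subset (nbar s) → Subset n
  project B = comprehend (over? B)

  ∈-project⁻ : ∀ {B i} → i ∈ project B → ∃ λ x → x ∈ B × base x ≡ i
  ∈-project⁻ {B} = ∈-comprehend⁻ (over? B)

  project-⊆ : ∀ {A B} → A ⊆ B → project A ⊆ project B
  project-⊆ {A} {B} A⊆B i∈ with ∈-project⁻ {A} i∈
  ... | x , x∈ , eq = ∈-comprehend⁺ (over? B) (x , A⊆B x∈ , eq)

  -- All copies of an element lie in the same part, so a transversal has at most one of them.
  ∣project∣ : ∀ B → Transversal π B → ∣ project B ∣ ≡ ∣ B ∣
  ∣project∣ B transversal = ℕ.≤-antisym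
    (∣∣-≤ (λ i x → base x ≡ i) (∈-project⁻ {B}) (λ _ _ eq eq′ → trans (sym eq) eq′))
    (∣∣-≤ (λ x i → base x ≡ i) (λ {x} x∈ → base x , ∈-comprehend⁺ (over? B) (x , x∈ , refl) , refl)
      (λ x∈ y∈ eq eq′ → transversal x∈ y∈ (cong part (trans eq (sym eq′)))))

  -- The sets containing i use distinct copies of i, and there are `s i` of these.
  project-SDisjoint : ∀ {r} {C : Family r (nbar s)} {A : Family r n} → Disjoint C →
                      (∀ j → A j ⊆ project (C j)) → SDisjoint s A
  project-SDisjoint {r} {C} {A} disjoint A⊆ i = subst (mult A i ≤_) (∣⊤∣≡n (s i)) (∣∣-≤ {B = ⊤} R related injective)
    where
    R : Fin r → Fin (s i) → Set
    R j c = ∃ λ x → x ∈ C j × copyOf s x ≡ (i , toℕ c)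
    related : ∀ {j} → j ∈ tabulate (λ j → lookup (A j) i) → ∃ λ c → c ∈ ⊤ × R j c
    related {j} j∈ with ∈-project⁻ {C j} (A⊆ j (lookup⇒∈ (trans (sym (Vec.lookup∘tabulate _ j)) (∈⇒lookup j∈))))
    ... | x , x∈ , refl = fromℕ< (copyOf-< s x) , ∈⊤ , x , x∈ , cong (base x ,_) (sym (Fin.toℕ-fromℕ< (copyOf-< s x)))
    injective : ∀ {j j′ c} → j ∈ _ → j′ ∈ _ → R j c → R j′ c → j ≡ j′
    injective _ _ (x , x∈ , eq) (y , y∈ , eq′) with copyOf-injective s {x} {y} (trans eq (sym eq′))
    ... | refl = disjoint x∈ y∈

  IsVertex : Subset n → Set
  IsVertex A = T (F A) × (∀ j → ∣ A ∩ P j ∣ ≤ 1)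

  vertex? : ∀ A → Dec (IsVertex A)
  vertex? A = T? (F A) ×-dec Fin.all? λ j → ∣ A ∩ P j ∣ ℕ.≤? 1

  -- c may depend on the proof that a set is a vertex, so one such proof is fixed.
  colourOf : Subset n → Maybe (Fin k)
  colourOf A with vertex? A
  ... | yes v = just (c (A , v))
  ... | no  _ = nothing

  colourOf-just : ∀ {A a} → colourOf A ≡ just a → ∃ λ v → c (A , v) ≡ a
  colourOf-just {A} eq with vertex? A
  ... | yes v = v , Maybe.just-injective eq

  colourOf-vertex : ∀ {A} → IsVertex A → ∃ λ a → colourOf A ≡ just a
  colourOf-vertex {A} v with vertex? A
  ... | yes v′ = c (A , v′) , refl
  ... | no ¬v  = contradiction v ¬v

  G : Fin k → Subset (nbar s) → Set
  G a B = ∃ λ A → A ⊆ project B × colourOf A ≡ just a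

  G? : ∀ a B → Dec (G a B)
  G? a B = anySubset? λ A → (A ⊆? project B) ×-dec Maybe.≡-dec Fin._≟_ (colourOf A) (just a)

  monochromatic : ∀ a (C : Family (suc d) (nbar s)) → Packing π C → ¬ (∀ i → G a (C i))
  monochromatic a C (disjoint , _) g = proper
    (λ j → proj₁ (g j) , proj₁ (colourOf-just (proj₂ (proj₂ (g j)))))
    (project-SDisjoint {C = C} disjoint (λ j → proj₁ (proj₂ (g j))))
    (a , λ j → proj₂ (colourOf-just (proj₂ (proj₂ (g j)))))

  module _ (S : Solution d π G) where
    open Solution S

    -- Trimmed to sizes `level` and `suc level`, which makes the projections equitable and realizes
    -- the truncated sizes in `bound`.
    D : Family (suc d) (nbar s)
    D j = take (suc level) (family j)

    D-disjoint : Disjoint D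
    D-disjoint x∈i x∈j = proj₁ packing (take-⊆ _ _ x∈i) (take-⊆ _ _ x∈j)

    D-transversal : ∀ j → Transversal π (D j)
    D-transversal j x∈ y∈ = proj₂ packing j (take-⊆ _ _ x∈) (take-⊆ _ _ y∈)

    A : Family (suc d) n
    A j = project (D j)

    ∣A∣ : ∀ j → ∣ A j ∣ ≡ ∣ family j ∣ ⊓ suc level
    ∣A∣ j = trans (∣project∣ (D j) (D-transversal j)) (∣take∣ (suc level) (family j))

    A-equitable : Equitable A
    A-equitable i j = begin
      ∣ A i ∣                         ≡⟨ ∣A∣ i ⟩
      ∣ family i ∣ ⊓ suc level        ≤⟨ ℕ.m⊓n≤n _ (suc level) ⟩
      suc level                       ≤⟨ s≤s (ℕ.⊓-glb (proj₁ isMin j) (ℕ.n≤1+n level)) ⟩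
      suc (∣ family j ∣ ⊓ suc level)  ≡⟨ cong suc (sym (∣A∣ j)) ⟩
      suc ∣ A j ∣                     ∎
      where open ℕ.≤-Reasoning

    -- Guarantees that a member of the family inside `A j` is a vertex and so has a colour. In
    -- `A-free` this colour contradicts `free`.
    A-meets-parts : ∀ {B} j → B ⊆ A j → ∀ j′ → ∣ B ∩ P j′ ∣ ≤ 1
    A-meets-parts {B} j B⊆ j′ =
      ∣∣-≤ {B = true ∷ []} (λ _ y → y ≡ zero) (λ _ → zero , here , refl) (λ i∈ i′∈ _ _ → unique i∈ i′∈)
      where
      unique : ∀ {i i′} → i ∈ B ∩ P j′ → i′ ∈ B ∩ P j′ → i ≡ i′
      unique i∈ i′∈ with x∈p∩q⁻ B (P j′) i∈ | x∈p∩q⁻ B (P j′) i′∈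
      ... | i∈B , i∈P | i′∈B , i′∈P with ∈-project⁻ {D j} (B⊆ i∈B) | ∈-project⁻ {D j} (B⊆ i′∈B)
      ...   | x , x∈ , refl | y , y∈ , refl =
        cong base (D-transversal j x∈ y∈ (trans (sym (part-unique i∈P)) (part-unique i′∈P)))

    A-free : FFree F A
    A-free B FB j B⊆ with colourOf-vertex {B} (FB , A-meets-parts j B⊆)
    ... | a , eq = free a j (B , (λ i∈ → project-⊆ (take-⊆ (suc level) (family j)) (B⊆ i∈)) , eq)

    A-admissible : Admissible s F A
    A-admissible = A-equitable , project-SDisjoint {C = D} D-disjoint (λ _ i∈ → i∈) , A-free

    A-total : nbar s ≤ total A + d * k
    A-total = subst (λ z → nbar s ≤ z + d * k) (∑-cong λ j → sym (∣A∣ j)) bound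

theorem6 : (n r : ℕ) → 1 ≤ n → 2 ≤ r
    → (s : Fin n → ℕ) → (∀ i → s i ≤ r)
    → (F : Subset n → Bool) → (∀ A → T (F A) → Nonempty A)
    → (l : ℕ) (P : Fin l → Subset n) → IsPartition P → (∀ j → wt s (P j) ≤ r)
    → (e : ℕ) → IsECD r s F e
    → χKG≥ r s F P (ceilDiv e (r ∸ 1))
theorem6 n (suc d) _ (s≤s 1≤d) s _ F _ l P partition light e (M , (_ , maximal) , refl) k c proper =
  -- Maximality bounds the total of the constructed family by `M`, so the defect is at most `d * k`.
  ceilDiv-≤ d 1≤d (ℕ.m≤n+o⇒m∸n≤o (nbar s) M
    (ℕ.≤-trans (A-total solution) (ℕ.+-monoˡ-≤ (d * k) (maximal (A solution) (A-admissible solution)))))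
  where
  open Copies s F P partition light c proper
  solution : Solution d π G
  solution = Bound-all d 1≤d π ρ π-ρ-injective G G? monochromatic
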